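{- There exist $b_0>0$ and $n_0 \in \mathbb{N}$ such that the following holds. If $n > n_0$, $n^{ -0.1} < b < b_0$, and $G$ is a $b$-typical graph on $n$ vertices with $d(G) > b$, then there is a set $N$ of edge-disjoint triangles in $G$ such that the graph $L = G \setminus \bigcup N$ (the edges of $G$ not covered by any triangle of $N$) is $b^{1/4}$-bounded.
   Context: All graphs are finite and simple. For a graph $G$ on $n$ vertices, its density is $d(G) = |E(G)|/\binom{n}{2}$. Writing $x \pm y$ for an unspecified real number between $x-y$ and $x+y$, a graph $G$ on $n$ vertices is $b$-typical if every vertex has $(1 \pm b)\, d(G)\, n$ neighbours and every pair of distinct vertices has $(1 \pm b)\, d(G)^2 n$ common neighbours. A subgraph $J \subseteq G$ (on the vertex set $V(G)$, $|V(G)|=n$) is $c$-bounded if every vertex $v$ has fewer than $cn$ neighbours in $J$. -}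

module Defs where

import Algebra.Definitions.RawSemiring as RawSemiringDefinitions
open import Data.Fin as Fin using (Fin)
open import Data.Fin.Subset using (Subset; _∈_; _∩_; ∣_∣)
open import Data.Fin.Subset.Properties using (_∈?_)
open import Data.Integer using (+_)
open import Data.List using (List; allFin; cartesianProduct; filter; length)
open import Data.List.Relation.Unary.All using (All)
open import Data.List.Relation.Unary.AllPairs using (AllPairs)
open import Data.List.Relation.Unary.Any using (Any; any?)
import Data.List.Relation.Unary.Any as Any
open import Data.Nat as ℕ using (ℕ; zero; suc)
open import Data.Nat.Combinatorics using (_C_)
open import Data.Product using (∃-syntax; _×_; _,_; swap)
open import Data.Rational as ℚ
  using (ℚ; 0ℚ; 1ℚ; _/_; _+_; _-_; _*_; _<_; _≤_; Positive; positive; nonNegative)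
import Data.Rational.Properties as ℚ
open import Data.Sum using (_⊎_; inj₁; inj₂)
import Data.Sum as Sum
open import Data.Vec using (tabulate)
open import Relation.Binary using (Rel; Symmetric; Irreflexive; Decidable; tri<; tri≈; tri>)
open import Relation.Binary.PropositionalEquality using (_≡_; _≢_; refl; subst₂)
open import Relation.Nullary using (¬_; yes; no; does)
open import Relation.Nullary.Decidable using (_×-dec_; ¬?)
open import Level using (0ℓ)

open RawSemiringDefinitions ℚ.+-*-rawSemiring using (_^_)

-- Real numbers as two-sided Dedekind cuts: L q reads "q < x", U q reads "x < q".
record ℝ : Set₁ where
  field
    L U         : ℚ → Set
    L-inhabited : ∃[ q ] L q
    U-inhabited : ∃[ q ] U q
    L-closed    : ∀ {q r} → q < r → L r → L q
    U-closed    : ∀ {q r} → q < r → U q → U r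
    L-rounded   : ∀ {q} → L q → ∃[ r ] q < r × L r
    U-rounded   : ∀ {r} → U r → ∃[ q ] q < r × U q
    disjoint    : ∀ {q} → L q → ¬ U q
    located     : ∀ {q r} → q < r → L q ⊎ U r

open ℝ public

infix 4 _<ᵣ_
_<ᵣ_ : ℝ → ℝ → Set
x <ᵣ y = ∃[ q ] U x q × L y q

fromℚ : ℚ → ℝ
fromℚ p = record
  { L           = _< p
  ; U           = p <_
  ; L-inhabited = p - 1ℚ , p-1<p
  ; U-inhabited = p + 1ℚ , p<p+1
  ; L-closed    = ℚ.<-trans
  ; U-closed    = λ q<r p<q → ℚ.<-trans p<q q<r
  ; L-rounded   = ℚ.<-dense
  ; U-rounded   = λ p<r → let m , p<m , m<r = ℚ.<-dense p<r in m , m<r , p<m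
  ; disjoint    = ℚ.<-asym
  ; located     = loc
  }
  where
  p-1<p : p - 1ℚ < p
  p-1<p = subst₂ _<_ refl (ℚ.+-identityʳ p) (ℚ.+-monoʳ-< p (ℚ.negative⁻¹ (ℚ.- 1ℚ)))

  p<p+1 : p < p + 1ℚ
  p<p+1 = subst₂ _<_ (ℚ.+-identityʳ p) refl (ℚ.+-monoʳ-< p (ℚ.positive⁻¹ 1ℚ))

  loc : ∀ {q r} → q < r → q < p ⊎ p < r
  loc {q} {r} q<r with ℚ.<-cmp q p
  ... | tri< q<p _ _ = inj₁ q<p
  ... | tri≈ _ q≡p _ = inj₂ (subst₂ _<_ q≡p refl q<r)
  ... | tri> _ _ p<q = inj₂ (ℚ.<-trans p<q q<r)

private
  ^-pos : ∀ {q} k → 0ℚ < q → 0ℚ < q ^ k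
  ^-pos zero    _   = ℚ.positive⁻¹ 1ℚ
  ^-pos {q} (suc k) 0<q =
    ℚ.positive⁻¹ (q * q ^ k)
      {{ℚ.pos*pos⇒pos q {{positive 0<q}} (q ^ k) {{positive (^-pos k 0<q)}}}}

  ^-mono-≤ : ∀ {q r} k → 0ℚ < q → q ≤ r → q ^ k ≤ r ^ k
  ^-mono-≤ zero _ _ = ℚ.≤-refl
  ^-mono-≤ {q} {r} (suc k) 0<q q≤r = ℚ.≤-trans
    (ℚ.*-monoˡ-≤-nonNeg q {{nonNegative (ℚ.<⇒≤ 0<q)}} (^-mono-≤ k 0<q q≤r))
    (ℚ.*-monoʳ-≤-nonNeg (r ^ k)
      {{nonNegative (ℚ.<⇒≤ (^-pos k (ℚ.<-≤-trans 0<q q≤r)))}} q≤r)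

  ^-mono-< : ∀ {q r} k → 0ℚ < q → q < r → q ^ suc k < r ^ suc k
  ^-mono-< {q} {r} k 0<q q<r = ℚ.≤-<-trans
    (ℚ.*-monoˡ-≤-nonNeg q {{nonNegative (ℚ.<⇒≤ 0<q)}} (^-mono-≤ k 0<q (ℚ.<⇒≤ q<r)))
    (ℚ.*-monoˡ-<-pos (r ^ k) {{positive (^-pos k (ℚ.<-trans 0<q q<r))}} q<r)

  1≤^ : ∀ {q} k → 1ℚ ≤ q → 1ℚ ≤ q ^ k
  1≤^ zero    _   = ℚ.≤-refl
  1≤^ {q} (suc k) 1≤q = ℚ.≤-trans 1≤q (subst₂ _≤_ (ℚ.*-identityʳ q) refl
    (ℚ.*-monoˡ-≤-nonNeg q
      {{nonNegative (ℚ.≤-trans (ℚ.nonNegative⁻¹ 1ℚ) 1≤q)}} (1≤^ k 1≤q)))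

  q≤q^ : ∀ {q} k → 1ℚ ≤ q → q ≤ q ^ suc k
  q≤q^ {q} k 1≤q = subst₂ _≤_ (ℚ.*-identityʳ q) refl
    (ℚ.*-monoˡ-≤-nonNeg q
      {{nonNegative (ℚ.≤-trans (ℚ.nonNegative⁻¹ 1ℚ) 1≤q)}} (1≤^ k 1≤q))

-- root k x is the k-th root of x when 0 ≤ x (and 0 when x < 0).  Quantifying over
-- an intermediate r makes both cuts rounded by density of ℚ; by continuity of
-- powers this does not change the real number being defined.
root : (k : ℕ) .{{_ : ℕ.NonZero k}} → ℝ → ℝ
root (suc k) x = record
  { L           = Lᵏ
  ; U           = Uᵏ
  ; L-inhabited = ℚ.- 1ℚ , 0ℚ , ℚ.negative⁻¹ (ℚ.- 1ℚ) , inj₁ ℚ.≤-refl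
  ; U-inhabited = inhabited
  ; L-closed    = λ q<r (s , r<s , p) → s , ℚ.<-trans q<r r<s , p
  ; U-closed    = λ q<r (s , s<q , p) → s , ℚ.<-trans s<q q<r , p
  ; L-rounded   = λ (s , q<s , p) →
                    let m , q<m , m<s = ℚ.<-dense q<s in m , q<m , s , m<s , p
  ; U-rounded   = λ (s , s<r , p) →
                    let m , s<m , m<r = ℚ.<-dense s<r in m , m<r , s , s<m , p
  ; disjoint    = disj
  ; located     = loc
  }
  where
  Lᵏ Uᵏ : ℚ → Set
  Lᵏ q = ∃[ r ] q < r × (r ≤ 0ℚ ⊎ L x (r ^ suc k))
  Uᵏ q = ∃[ r ] r < q × 0ℚ < r × U x (r ^ suc k)

  U-up : ∀ {q r} → q ≤ r → U x q → U x r
  U-up {q} {r} q≤r uq =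
    let p , p<q , up = U-rounded x uq in U-closed x (ℚ.<-≤-trans p<q q≤r) up

  inhabited : ∃[ q ] Uᵏ q
  inhabited =
    let u , xu = U-inhabited x
        r      = 1ℚ ℚ.⊔ u
        1≤r    = ℚ.p≤p⊔q 1ℚ u
        r<r+1  = subst₂ _<_ (ℚ.+-identityʳ r) refl (ℚ.+-monoʳ-< r (ℚ.positive⁻¹ 1ℚ))
    in r + 1ℚ , r , r<r+1 , ℚ.<-≤-trans (ℚ.positive⁻¹ 1ℚ) 1≤r
       , U-up (ℚ.≤-trans (ℚ.p≤q⊔p 1ℚ u) (q≤q^ k 1≤r)) xu

  disj : ∀ {q} → Lᵏ q → ¬ Uᵏ q
  disj (r , q<r , inj₁ r≤0) (s , s<q , 0<s , _) =
    ℚ.<-asym 0<s (ℚ.<-≤-trans (ℚ.<-trans s<q q<r) r≤0)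
  disj (r , q<r , inj₂ lr) (s , s<q , 0<s , us) =
    disjoint x lr (U-closed x (^-mono-< k 0<s (ℚ.<-trans s<q q<r)) us)

  loc : ∀ {q r} → q < r → Lᵏ q ⊎ Uᵏ r
  loc {q} {r} q<r with ℚ.<-dense q<r
  ... | m , q<m , m<r with ℚ.<-dense m<r | m ℚ.≤? 0ℚ
  ... | _              | yes m≤0 = inj₁ (m , q<m , inj₁ m≤0)
  ... | s , m<s , s<r  | no  m≰0 =
    let 0<m = ℚ.≰⇒> m≰0 in
    Sum.map (λ lm → m , q<m , inj₂ lm)
            (λ us → s , s<r , ℚ.<-trans 0<m m<s , us)
            (located x (^-mono-< k 0<m m<s))

-- y lies in the closed interval [(1-b)z , (1+b)z], for rational z ≥ 0.  As b is the
-- infimum of the rationals above it, this amounts to the same bounds for all of those.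
_∈1±_·_ : ℚ → ℝ → ℚ → Set
y ∈1± b · z = ∀ r → U b r → (1ℚ - r) * z ≤ y × y ≤ (1ℚ + r) * z

fromℕ : ℕ → ℚ
fromℕ a = + a / 1

-- The value at denominator 0 is a placeholder.
ratio : ℕ → ℕ → ℚ
ratio a zero      = 0ℚ
ratio a n@(suc _) = + a / n

record Graph (n : ℕ) : Set₁ where
  field
    Adj    : Rel (Fin n) 0ℓ
    symm   : Symmetric Adj
    irrefl : Irreflexive _≡_ Adj
    adj?   : Decidable Adj

  neighbours : Fin n → Subset n
  neighbours v = tabulate λ w → does (adj? v w)

  degree : Fin n → ℕ
  degree v = ∣ neighbours v ∣

  codegree : Fin n → Fin n → ℕ
  codegree u v = ∣ neighbours u ∩ neighbours v ∣

  edges : List (Fin n × Fin n)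
  edges = filter (λ (u , v) → (u Fin.<? v) ×-dec adj? u v)
                 (cartesianProduct (allFin n) (allFin n))

  density : ℚ
  density = ratio (length edges) (n C 2)

open Graph public

module _ {n : ℕ} where

  Typical : ℝ → Graph n → Set
  Typical b G =
      (∀ v → fromℕ (degree G v) ∈1± b · (density G * fromℕ n))
    × (∀ u v → u ≢ v →
         fromℕ (codegree G u v) ∈1± b · (density G * density G * fromℕ n))

  -- Degree less than c n means degree less than q n for some rational q < c.
  Bounded : ℝ → Graph n → Set
  Bounded c J = ∀ v → ∃[ q ] L c q × fromℕ (degree J v) < q * fromℕ n

  -- Triangles are represented by their vertex sets.
  IsTriangle : Graph n → Subset n → Set
  IsTriangle G T = ∣ T ∣ ≡ 3 × (∀ {u v} → u ∈ T → v ∈ T → u ≢ v → Adj G u v)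

  EdgeDisjoint : Subset n → Subset n → Set
  EdgeDisjoint S T = ∀ {u v} → u ≢ v → ¬ ((u ∈ S × v ∈ S) × (u ∈ T × v ∈ T))

  -- The list has no repetitions, since a triangle is not edge-disjoint from itself.
  EdgeDisjointTriangles : Graph n → List (Subset n) → Set
  EdgeDisjointTriangles G N = All (IsTriangle G) N × AllPairs EdgeDisjoint N

  Covered : List (Subset n) → Rel (Fin n) 0ℓ
  Covered N u v = Any (λ T → u ∈ T × v ∈ T) N

  _∖⋃_ : Graph n → List (Subset n) → Graph n
  G ∖⋃ N = record
    { Adj    = λ u v → Adj G u v × ¬ Covered N u v
    ; symm   = λ (a , ¬c) → symm G a , λ c → ¬c (Any.map swap c)
    ; irrefl = λ u≡v (a , _) → irrefl G u≡v a
    ; adj?   = λ u v →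
        adj? G u v ×-dec ¬? (any? (λ T → (u ∈? T) ×-dec (v ∈? T)) N)
    }

{-# OPTIONS --safe #-}
module Submission where

-- Random greedy triangle removal, derandomised.  Remove triangles one at a time and
-- charge time h = 6/#tri (#tri counts ordered triangles) to each removal.  A uniformly
-- chosen triangle then changes a codegree near M by about -2M²h, so all codegrees are
-- expected to follow M′ = -2M², that is roughly M = 1/(2s) at time s; #tri has
-- dropped out of this equation.  The potential Φ adds up the eighth powers of the amounts by which
-- the codegrees leave the envelope [M - D , M + D], whose half-width D grows slowly.
-- A codegree outside the envelope is pushed back on average, so Φ grows only at second
-- order, and some triangle does no worse than the average.  Hence Φ stays too small for
-- any codegree to leave the envelope by more than η.  The process stops when M is of
-- order e²n with e about b^(1/4); double counting of paths of length two then bounds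
-- every remaining degree by en.

-- Codegrees can be tracked without a blow-up because errors cancel to first order. A pair at the
-- top edge M + D loses codegree most slowly when the pairs that govern its loss lie at the bottom
-- edge M - D; the rate is then still 2(M + D)(M - D) = 2M² - 2D², with no term linear in D. The
-- bottom edge is symmetric. So D may grow at a constant rate κ of order e⁶n²; over a time of order
-- 1/(e²n) it remains of order e⁴n, well below the final M of order e²n. A term of order MD would
-- instead multiply D by a power of the ratio of the initial to the final M.
--
-- All estimates are polynomial in n, a rational e and its inverse K. The real b is replaced by an e
-- with 16e⁴ < b < 512e⁴, so that the initial error fits into D at time 0, and n^(-0.1) < b becomes
-- ne³² ≥ 1. If the density is at most e/8, no triangle is removed, since all degrees are already
-- small.

open import Defs
open import Data.Bool using (Bool; true; false; _∧_; _∨_; not)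
open import Data.Bool.Properties using (∧-identityʳ)
open import Data.Fin as Fin using (Fin; zero; suc)
open import Data.Fin.Subset using (Subset; _∈_; _∩_; ∣_∣)
open import Data.Fin.Subset.Properties using (_∈?_)
open import Data.Integer as ℤ using () renaming (+_ to pos)
import Data.Integer.Properties as ℤ
open import Data.List using (List; []; _∷_)
open import Data.List.Membership.Propositional using (lose)
import Data.List.Relation.Unary.All as All
open import Data.List.Relation.Unary.All using ([]; _∷_)
open import Data.List.Relation.Unary.AllPairs using ([]; _∷_)
open import Data.List.Relation.Unary.Any using (any?)
open import Data.Maybe using (Maybe; just; nothing)
open import Data.Nat as ℕ using (ℕ; zero; suc)
open import Data.Nat.Coprimality as Coprimality using (1-coprimeTo)
open import Data.Product using (Σ-syntax; ∃-syntax; _×_; _,_; proj₁; proj₂)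
open import Data.Rational as ℚ using (ℚ; 0ℚ; 1ℚ; _+_; _-_; _*_; -_; _≤_; _<_; _⊔_; positive; nonNegative)
import Data.Rational.Properties as ℚ
open import Data.Sum as Sum using (_⊎_; inj₁; inj₂; [_,_]′)
open import Data.Vec using (tabulate) renaming (_∷_ to _∷ᵥ_)
open import Data.Vec.Properties using (lookup∘tabulate; []=⇒lookup; lookup⇒[]=)
open import Algebra.Bundles using (CommutativeRing)
open import Algebra.Properties.Semiring.Sum (CommutativeRing.semiring ℚ.+-*-commutativeRing)
  using (sum; sum-cong-≗; sum-replicate-zero; ∑-distrib-+; ∑-comm; *-distribˡ-sum)
open import Function using (case_of_; id; mk⇔)
open import Relation.Binary.PropositionalEquality
open import Relation.Nullary using (Dec; yes; no; does; contradiction)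
open import Relation.Nullary.Decidable using (toWitness; toWitnessFalse; dec-true; dec-false; does-⇔; _×-dec_)
import Algebra.Definitions.RawSemiring as RawSemiringDefinitions
open RawSemiringDefinitions ℚ.+-*-rawSemiring using (_^_)
import Tactic.RingSolver.Core.AlmostCommutativeRing as ACR
open import Tactic.RingSolver using (solve-∀)

-- Inequalities between rationals

ℚ-ring : ACR.AlmostCommutativeRing _ _
ℚ-ring = ACR.fromCommutativeRing ℚ.+-*-commutativeRing isZero
  where
  isZero : ∀ x → Maybe (0ℚ ≡ x)
  isZero x with 0ℚ ℚ.≟ x
  ... | yes 0≡x = just 0≡x
  ... | no  _   = nothing

infixl 6 _⊕_ _⊕<_
infixl 7 _⊗_ _⊗<_

_⊕_ : ∀ {p q} → 0ℚ ≤ p → 0ℚ ≤ q → 0ℚ ≤ p + q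
_⊕_ = ℚ.+-mono-≤

_⊗_ : ∀ {p q} → 0ℚ ≤ p → 0ℚ ≤ q → 0ℚ ≤ p * q
_⊗_ {p} {q} 0≤p 0≤q = subst (_≤ p * q) (ℚ.*-zeroʳ p)
  (ℚ.*-monoˡ-≤-nonNeg p {{nonNegative 0≤p}} 0≤q)

_⊕<_ : ∀ {p q} → 0ℚ ≤ p → 0ℚ < q → 0ℚ < p + q
_⊕<_ = ℚ.+-mono-≤-<

_⊗<_ : ∀ {p q} → 0ℚ < p → 0ℚ < q → 0ℚ < p * q
_⊗<_ {p} {q} 0<p 0<q = subst (_< p * q) (ℚ.*-zeroʳ p)
  (ℚ.*-monoʳ-<-pos p {{positive 0<p}} 0<q)

-- fromℕ k in lowest terms, so that the ring solver need not reduce its coefficients.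
Q : ℕ → ℚ
Q k = ℚ.mkℚ (pos k) 0 (Coprimality.sym (1-coprimeTo k))

fromℕ≡Q : ∀ k → fromℕ k ≡ Q k
fromℕ≡Q k = ℚ.normalize-coprime (Coprimality.sym (1-coprimeTo k))

lit : ∀ k → 0ℚ ≤ Q k
lit k = ℚ.nonNegative⁻¹ (Q k)

lit< : ∀ k → 0ℚ < Q (suc k)
lit< k = ℚ.positive⁻¹ (Q (suc k))

0≤1 : 0ℚ ≤ 1ℚ
0≤1 = lit 1

gap : ∀ {p q} → p ≤ q → 0ℚ ≤ q - p
gap {p} {q} p≤q = subst (_≤ q - p) (ℚ.+-inverseʳ p) (ℚ.+-monoˡ-≤ (- p) p≤q)

gap< : ∀ {p q} → p < q → 0ℚ < q - p
gap< {p} {q} p<q = subst (_< q - p) (ℚ.+-inverseʳ p) (ℚ.+-monoˡ-< (- p) p<q)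

private
  p+[q-p] : ∀ p q → p + (q - p) ≡ q
  p+[q-p] = solve-∀ ℚ-ring

-- The form of nearly every estimate below: q - p is rewritten by the ring solver as an expression
-- `x` whose sign is visible, and the certificate 0 ≤ x, built from `_⊕_` and `_⊗_`, repeats the
-- shape of `x`.
≤-by : ∀ {p q x} → 0ℚ ≤ x → q - p ≡ x → p ≤ q
≤-by {p} {q} 0≤x refl =
  subst₂ _≤_ (ℚ.+-identityʳ p) (p+[q-p] p q) (ℚ.+-monoʳ-≤ p 0≤x)

<-by : ∀ {p q x} → 0ℚ < x → q - p ≡ x → p < q
<-by {p} {q} 0<x refl =
  subst₂ _<_ (ℚ.+-identityʳ p) (p+[q-p] p q) (ℚ.+-monoʳ-< p 0<x)

0≤sq : ∀ x → 0ℚ ≤ x * x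
0≤sq x with ℚ.≤-total 0ℚ x
... | inj₁ 0≤x = 0≤x ⊗ 0≤x
... | inj₂ x≤0 = subst (0ℚ ≤_) (eq x) (gap x≤0 ⊗ gap x≤0)
  where
  eq : ∀ x → (0ℚ - x) * (0ℚ - x) ≡ x * x
  eq = solve-∀ ℚ-ring

*-mono-≤ : ∀ {p q r s} → 0ℚ ≤ p → 0ℚ ≤ r → p ≤ q → r ≤ s → p * r ≤ q * s
*-mono-≤ {p} {q} {r} {s} 0≤p 0≤r p≤q r≤s =
  ≤-by (gap p≤q ⊗ (0≤r ⊕ gap r≤s) ⊕ 0≤p ⊗ gap r≤s) (eq p q r s)
  where
  eq : ∀ p q r s → q * s - p * r ≡ (q - p) * (r + (s - r)) + p * (s - r)
  eq = solve-∀ ℚ-ring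

*-monoˡ-≤ : ∀ r {p q} → 0ℚ ≤ r → p ≤ q → r * p ≤ r * q
*-monoˡ-≤ r 0≤r = ℚ.*-monoˡ-≤-nonNeg r {{nonNegative 0≤r}}

*-cancelˡ-≤ : ∀ r {p q} → 0ℚ < r → r * p ≤ r * q → p ≤ q
*-cancelˡ-≤ r 0<r = ℚ.*-cancelˡ-≤-pos r {{positive 0<r}}

*-cancelˡ-< : ∀ r {p q} → 0ℚ < r → r * p < r * q → p < q
*-cancelˡ-< r 0<r = ℚ.*-cancelˡ-<-nonNeg r {{nonNegative (ℚ.<⇒≤ 0<r)}}

-- Positive parts and eighth powers

infix 9 _⁺ _²
_⁺ : ℚ → ℚ
x ⁺ = x ⊔ 0ℚ

_² : ℚ → ℚ
x ² = x * x

_⁸ : ℚ → ℚ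
x ⁸ = ((x ²) ²) ²

0≤x⁺ : ∀ x → 0ℚ ≤ x ⁺
0≤x⁺ x = ℚ.p≤q⊔p x 0ℚ

²-mono : ∀ {x y} → 0ℚ ≤ x → x ≤ y → x ² ≤ y ²
²-mono 0≤x x≤y = *-mono-≤ 0≤x 0≤x x≤y x≤y

⁸-mono : ∀ {x y} → 0ℚ ≤ x → x ≤ y → x ⁸ ≤ y ⁸
⁸-mono {x} 0≤x x≤y = ²-mono (0≤sq (x * x)) (²-mono (0≤sq x) (²-mono 0≤x x≤y))

0≤⁸ : ∀ x → 0ℚ ≤ x ⁸
0≤⁸ x = 0≤sq ((x ²) ²)

private
  expand⁺ : ∀ y t → (y * y * (y * y) * (y * y * (y * y)) + Q 8 * (y * y * y * y * y * y * y) * t + Q 28 *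
      (t * t) * ((y + t) * (y + t) * ((y + t) * (y + t)) * ((y + t) * (y + t)))) -
      ((y + t) * (y + t) * ((y + t) * (y + t)) * ((y + t) * (y + t) * ((y + t) * (y + t)))) ≡
     t * t * (Q 112 * (y * y * y * y * y * t) + Q 350 * (y * y * y * y * t * t)  + Q 504 *
         (y * y * y * t * t * t) + Q 392 * (y * y * t * t * t * t) + Q 160 * (y * t * t * t * t * t) + Q
         27 * (t * t * t * t * t * t))
  expand⁺ = solve-∀ ℚ-ring

  expand⁻ : ∀ y t → (y * y * (y * y) * (y * y * (y * y)) + Q 8 * (y * y * y * y * y * y * y) * (- t) + Q
      28 * (t * t) * ((y + t) * (y + t) * ((y + t) * (y + t)) * ((y + t) * (y + t)))) -
      ((y + (- t)) * (y + (- t)) * ((y + (- t)) * (y + (- t))) *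
      ((y + (- t)) * (y + (- t)) * ((y + (- t)) * (y + (- t))))) ≡
     t * t * (Q 224 * (y * y * y * y * y * t) + Q 350 * (y * y * y * y * t * t)  + Q 616 *
         (y * y * y * t * t * t) + Q 392 * (y * y * t * t * t * t) + Q 176 * (y * t * t * t * t * t) + Q
         27 * (t * t * t * t * t * t))
  expand⁻ = solve-∀ ℚ-ring

_⁷ : ℚ → ℚ
y ⁷ = y * y * y * y * y * y * y

private
  -- Taylor's formula: half the second derivative of x⁸ is 28x⁶, and |x| ≤ y + t between y and y +
  -- Δ. The difference of the two sides, in `expand⁺` and `expand⁻`, has only positive coefficients.
  ⁸-step : ∀ {y} Δ {t} → 0ℚ ≤ y → 0ℚ ≤ t → Δ ≡ t ⊎ Δ ≡ - t →
    (y + Δ) ⁸ ≤ y ⁸ + Q 8 * y ⁷ * Δ + Q 28 * (Δ * Δ) * ((y + t) ² * (y + t) ² * (y + t) ²)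
  ⁸-step {y} Δ {t} 0≤y 0≤t (inj₁ refl) = ≤-by
    (t' ⊗ t' ⊗ (lit 112 ⊗ (y' ⊗ y' ⊗ y' ⊗ y' ⊗ y' ⊗ t') ⊕ lit 350 ⊗ (y' ⊗ y' ⊗ y' ⊗ y' ⊗ t' ⊗ t')
      ⊕ lit 504 ⊗ (y' ⊗ y' ⊗ y' ⊗ t' ⊗ t' ⊗ t') ⊕ lit 392 ⊗ (y' ⊗ y' ⊗ t' ⊗ t' ⊗ t' ⊗ t')
      ⊕ lit 160 ⊗ (y' ⊗ t' ⊗ t' ⊗ t' ⊗ t' ⊗ t') ⊕ lit 27 ⊗ (t' ⊗ t' ⊗ t' ⊗ t' ⊗ t' ⊗ t')))
    (expand⁺ y t)
    where y' = 0≤y ; t' = 0≤t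
  ⁸-step {y} Δ {t} 0≤y 0≤t (inj₂ refl) = ≤-by
    (t' ⊗ t' ⊗ (lit 224 ⊗ (y' ⊗ y' ⊗ y' ⊗ y' ⊗ y' ⊗ t') ⊕ lit 350 ⊗ (y' ⊗ y' ⊗ y' ⊗ y' ⊗ t' ⊗ t')
      ⊕ lit 616 ⊗ (y' ⊗ y' ⊗ y' ⊗ t' ⊗ t' ⊗ t') ⊕ lit 392 ⊗ (y' ⊗ y' ⊗ t' ⊗ t' ⊗ t' ⊗ t')
      ⊕ lit 176 ⊗ (y' ⊗ t' ⊗ t' ⊗ t' ⊗ t' ⊗ t') ⊕ lit 27 ⊗ (t' ⊗ t' ⊗ t' ⊗ t' ⊗ t' ⊗ t')))
    (trans (cong (λ z → y ⁸ + Q 8 * y ⁷ * (- t) + Q 28 * z * ((y + t) ² * (y + t) ² * (y + t) ²) - (y + - t) ⁸)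
      (neg² t)) (expand⁻ y t))
    where
    y' = 0≤y ; t' = 0≤t
    neg² : ∀ t → (- t) * (- t) ≡ t * t
    neg² = solve-∀ ℚ-ring

  -- First (y + t)² ≤ 2(Y + Θ), then the cube is convex, and finally Y³ is at most Θ³ or ψY⁴
  -- according to the side of Θ on which Y lies. The eighth power Y⁴ returns, so the remainder is
  -- bounded through the potential itself.
  six-bound : ∀ {Y t Θ ψ} → 0ℚ ≤ Y → 0ℚ ≤ t → t * t ≤ Θ → 0ℚ ≤ ψ → Θ * ψ ≡ 1ℚ → ∀ y → Y ≡ y * y →
    (y + t) ² * (y + t) ² * (y + t) ² ≤ Q 64 * (Θ * Θ * Θ + ψ * (Y * Y * (Y * Y)))
  six-bound {Y} {t} {Θ} {ψ} 0≤Y 0≤t tt≤Θ 0≤ψ Θψ≡1 y refl =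
    ℚ.≤-trans (*-mono-≤ (0≤sq (y + t) ⊗ 0≤sq (y + t)) (0≤sq (y + t))
      (*-mono-≤ (0≤sq (y + t)) (0≤sq (y + t)) sq≤ sq≤) sq≤)
    (ℚ.≤-trans cube≤ (≤-by (lit 32 ⊗ gap Y³≤) (eq₃ Y Θ ψ)))
    where
    eq₁ : ∀ y t Θ → Q 2 * (y * y + Θ) - (y + t) * (y + t) ≡ (y - t) * (y - t) + Q 2 * (Θ - t * t)
    eq₁ = solve-∀ ℚ-ring
    sq≤ : (y + t) ² ≤ Q 2 * (Y + Θ)
    sq≤ = ≤-by (0≤sq (y - t) ⊕ lit 2 ⊗ gap tt≤Θ) (eq₁ y t Θ)
    0≤Θ = ℚ.≤-trans (0≤sq t) tt≤Θ
    eq₂ : ∀ Y Θ → Q 32 * (Y * Y * Y + Θ * Θ * Θ) - Q 2 * (Y + Θ) * (Q 2 * (Y + Θ)) * (Q 2 * (Y + Θ)) ≡ Q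
        24 * ((Y + Θ) * ((Y - Θ) * (Y - Θ)))
    eq₂ = solve-∀ ℚ-ring
    cube≤ : Q 2 * (Y + Θ) * (Q 2 * (Y + Θ)) * (Q 2 * (Y + Θ)) ≤ Q 32 * (Y * Y * Y + Θ * Θ * Θ)
    cube≤ = ≤-by (lit 24 ⊗ ((0≤Y ⊕ 0≤Θ) ⊗ 0≤sq (Y - Θ))) (eq₂ Y Θ)
    eq₃ : ∀ Y Θ ψ → Q 64 * (Θ * Θ * Θ + ψ * (Y * Y * (Y * Y))) - Q 32 * (Y * Y * Y + Θ * Θ * Θ) ≡ Q 32 *
        (Θ * Θ * Θ + Q 2 * (ψ * (Y * Y * (Y * Y))) - Y * Y * Y)
    eq₃ = solve-∀ ℚ-ring
    eq₄ : ∀ Y Θ w → Θ * Θ * Θ + Q 2 * w - Y * Y * Y ≡ (Θ - Y) * (Θ * Θ + Θ * Y + Y * Y) + Q 2 * w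
    eq₄ = solve-∀ ℚ-ring
    eq₅ : ∀ Y Θ ψ → Θ * Θ * Θ + Q 2 * (ψ * (Y * Y * (Y * Y))) - Y * Y * Y ≡ Θ * Θ * Θ + ψ *
        (Y * Y * (Y * Y)) + ψ * (Y * Y * Y) * (Y - Θ) + (Θ * ψ - 1ℚ) * (Y * Y * Y)
    eq₅ = solve-∀ ℚ-ring
    Y³≤ : Y * Y * Y ≤ Θ * Θ * Θ + Q 2 * (ψ * (Y * Y * (Y * Y)))
    Y³≤ with ℚ.≤-total Y Θ
    ... | inj₁ Y≤Θ = ≤-by (gap Y≤Θ ⊗ (0≤Θ ⊗ 0≤Θ ⊕ 0≤Θ ⊗ 0≤Y ⊕ 0≤Y ⊗ 0≤Y) ⊕ lit 2 ⊗
        (0≤ψ ⊗ (0≤Y ⊗ 0≤Y ⊗ (0≤Y ⊗ 0≤Y))))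
      (eq₄ Y Θ (ψ * (Y * Y * (Y * Y))))
    ... | inj₂ Θ≤Y = ≤-by (0≤Θ ⊗ 0≤Θ ⊗ 0≤Θ ⊕ 0≤ψ ⊗ (0≤Y ⊗ 0≤Y ⊗ (0≤Y ⊗ 0≤Y)) ⊕ 0≤ψ ⊗ (0≤Y ⊗ 0≤Y ⊗ 0≤Y) ⊗
        gap Θ≤Y ⊕ subst (λ z → 0ℚ ≤ (z - 1ℚ) * (Y * Y * Y)) (sym Θψ≡1)
        (ℚ.≤-reflexive (sym (ℚ.*-zeroˡ (Y * Y * Y)))))
      (eq₅ Y Θ ψ)

  ⁺⁸≤ : ∀ x Δ → ((x + Δ) ⁺) ⁸ ≤ (x ⁺ + Δ) ⁸
  ⁺⁸≤ x Δ with ℚ.≤-total (x + Δ) 0ℚ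
  ... | inj₁ ≤0 = subst (λ z → z ⁸ ≤ (x ⁺ + Δ) ⁸) (sym (ℚ.p≤q⇒p⊔q≡q ≤0)) (0≤⁸ (x ⁺ + Δ))
  ... | inj₂ ≥0 = subst (λ z → z ⁸ ≤ (x ⁺ + Δ) ⁸) (sym (ℚ.p≥q⇒p⊔q≡p ≥0))
      (⁸-mono ≥0 (ℚ.+-monoˡ-≤ Δ (ℚ.p≤p⊔q x 0ℚ)))

-- Second-order Taylor bound for the potential; the sixth power in the remainder is
-- split at the scale y² = Θ.
⁺⁸-taylor : ∀ {Θ ψ} → Q 16 ≤ Θ → 0ℚ ≤ ψ → Θ * ψ ≡ 1ℚ → ∀ x {Δ t} → 0ℚ ≤ t → t ≤ Q 4 → Δ ≤ t → - t ≤ Δ →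
  ((x + Δ) ⁺) ⁸ ≤ (x ⁺) ⁸ + Q 8 * (x ⁺) ⁷ * Δ
    + Q 1792 * (Q 4 * t) * (Θ * Θ * Θ + ψ * (x ⁺) ⁸)
⁺⁸-taylor {Θ} {ψ} 16≤Θ 0≤ψ Θψ≡1 x {Δ} {t} 0≤t t≤4 Δ≤t -t≤Δ = ℚ.≤-trans (⁺⁸≤ x Δ) main
  where
  y = x ⁺
  0≤y = 0≤x⁺ x
  abs : ∃[ s ] 0ℚ ≤ s × s ≤ t × (Δ ≡ s ⊎ Δ ≡ - s)
  abs with ℚ.≤-total 0ℚ Δ
  ... | inj₁ 0≤Δ = Δ , 0≤Δ , Δ≤t , inj₁ refl
  ... | inj₂ Δ≤0 = - Δ , subst (0ℚ ≤_) (ℚ.+-identityˡ (- Δ)) (gap Δ≤0) , ≤-by (gap -t≤Δ) (e Δ t) , inj₂ (e' Δ)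
    where
    e : ∀ Δ t → t - (- Δ) ≡ Δ - (- t)
    e = solve-∀ ℚ-ring
    e' : ∀ Δ → Δ ≡ - (- Δ)
    e' = solve-∀ ℚ-ring
  s = proj₁ abs
  0≤s = proj₁ (proj₂ abs)
  s≤t = proj₁ (proj₂ (proj₂ abs))
  Δ=±s = proj₂ (proj₂ (proj₂ abs))
  s≤4 = ℚ.≤-trans s≤t t≤4
  ss≤Θ : s * s ≤ Θ
  ss≤Θ = ℚ.≤-trans (*-mono-≤ 0≤s 0≤s s≤4 s≤4) 16≤Θ
  ΔΔ≡ss : Δ * Δ ≡ s * s
  ΔΔ≡ss with Δ=±s
  ... | inj₁ Δ≡s = cong₂ _*_ Δ≡s Δ≡s
  ... | inj₂ Δ≡-s = trans (cong₂ _*_ Δ≡-s Δ≡-s) (e s)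
    where
    e : ∀ t → (- t) * (- t) ≡ t * t
    e = solve-∀ ℚ-ring
  -- One factor of Δ² is bounded by 4, to leave a bound linear in t: only the mean of t has to be
  -- known later.
  ΔΔ≤ : Δ * Δ ≤ Q 4 * t
  ΔΔ≤ = subst (_≤ Q 4 * t) (sym ΔΔ≡ss) (*-mono-≤ 0≤s 0≤s s≤4 s≤t)
  R = Θ * Θ * Θ + ψ * y ⁸
  six = six-bound (0≤sq y) 0≤s ss≤Θ 0≤ψ Θψ≡1 y refl
  0≤R : 0ℚ ≤ R
  0≤R = let 0≤Θ = ℚ.≤-trans (lit 16) 16≤Θ in 0≤Θ ⊗ 0≤Θ ⊗ 0≤Θ ⊕ 0≤ψ ⊗ 0≤⁸ y
  e₁ : ∀ a b t R → a + b + Q 1792 * (Q 4 * t) * R - (a + b + Q 28 * (Q 4 * t) * (Q 64 * R)) ≡ 0ℚ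
  e₁ = solve-∀ ℚ-ring
  -- 1792 is 28 from the Taylor remainder times 64 from `six-bound`.
  main : (y + Δ) ⁸ ≤ y ⁸ + Q 8 * y ⁷ * Δ + Q 1792 * (Q 4 * t) * R
  main = ℚ.≤-trans (⁸-step Δ 0≤y 0≤s Δ=±s)
    (ℚ.≤-trans (ℚ.+-monoʳ-≤ (y ⁸ + Q 8 * y ⁷ * Δ)
       (*-mono-≤ (lit 28 ⊗ 0≤sq Δ) (0≤sq (y + s) ⊗ 0≤sq (y + s) ⊗ 0≤sq (y + s))
           (*-mono-≤ (lit 28) (0≤sq Δ) ℚ.≤-refl ΔΔ≤) six))
     (≤-by ℚ.≤-refl (e₁ (y ⁸) (Q 8 * y ⁷ * Δ) t R)))

Q-suc : ∀ k → Q (suc k) ≡ 1ℚ + Q k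
Q-suc k = trans (sym (fromℕ≡Q (suc k))) (cong (ℚ._/ 1) (cong (λ i → pos 1 ℤ.+ i) (sym (ℤ.*-identityʳ (pos k)))))

-- Indicators

𝟙 : Bool → ℚ
𝟙 true  = 1ℚ
𝟙 false = 0ℚ

0≤𝟙 : ∀ p → 0ℚ ≤ 𝟙 p
0≤𝟙 true  = lit 1
0≤𝟙 false = ℚ.≤-refl

𝟙≤1 : ∀ p → 𝟙 p ≤ 1ℚ
𝟙≤1 true  = ℚ.≤-refl
𝟙≤1 false = lit 1

𝟙-idem : ∀ p → 𝟙 p * 𝟙 p ≡ 𝟙 p
𝟙-idem true  = refl
𝟙-idem false = refl

𝟙-∧ : ∀ p q → 𝟙 (p ∧ q) ≡ 𝟙 p * 𝟙 q
𝟙-∧ true  q = sym (ℚ.*-identityˡ (𝟙 q))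
𝟙-∧ false q = sym (ℚ.*-zeroˡ (𝟙 q))

𝟙-not : ∀ p → 𝟙 (not p) ≡ 1ℚ - 𝟙 p
𝟙-not true  = refl
𝟙-not false = refl

0<𝟙*⇒ : ∀ p {x} → 0ℚ < 𝟙 p * x → p ≡ true × 0ℚ < x
0<𝟙*⇒ true  {x} 0<  = refl , subst (0ℚ <_) (ℚ.*-identityˡ x) 0<
0<𝟙*⇒ false {x} 0<0 = contradiction (subst (0ℚ <_) (ℚ.*-zeroˡ x) 0<0) (ℚ.<-irrefl refl)

δ : ∀ {n} → Fin n → Fin n → ℚ
δ i j = 𝟙 (does (i Fin.≟ j))

δ-sym : ∀ {n} (i j : Fin n) → δ i j ≡ δ j i
δ-sym i j with i Fin.≟ j | j Fin.≟ i
... | yes _   | yes _   = refl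
... | no  _   | no  _   = refl
... | yes i≡j | no j≢i  = contradiction (sym i≡j) j≢i
... | no  i≢j | yes j≡i = contradiction (sym j≡i) i≢j

δ-suc : ∀ {n} (i j : Fin n) → δ (suc i) (suc j) ≡ δ i j
δ-suc i j with i Fin.≟ j | suc i Fin.≟ suc j
... | yes _    | yes _  = refl
... | no  _    | no  _  = refl
... | yes refl | no ¬p  = contradiction refl ¬p
... | no  ¬p   | yes refl = contradiction refl ¬p

-- Finite sums

opaque
  ∑ : ∀ {n} → (Fin n → ℚ) → ℚ
  ∑ = sum

  ∑-cong : ∀ {n} {f g : Fin n → ℚ} → (∀ i → f i ≡ g i) → ∑ f ≡ ∑ g
  ∑-cong = sum-cong-≗

  ∑-+ : ∀ {n} (f g : Fin n → ℚ) → ∑ (λ i → f i + g i) ≡ ∑ f + ∑ g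
  ∑-+ = ∑-distrib-+

  ∑-swap : ∀ {m n} (f : Fin m → Fin n → ℚ) → ∑ (λ i → ∑ λ j → f i j) ≡ ∑ (λ j → ∑ λ i → f i j)
  ∑-swap = ∑-comm

  *-∑ : ∀ {n} c (f : Fin n → ℚ) → c * ∑ f ≡ ∑ (λ i → c * f i)
  *-∑ = *-distribˡ-sum

  ∑-mono-≤ : ∀ {n} {f g : Fin n → ℚ} → (∀ i → f i ≤ g i) → ∑ f ≤ ∑ g
  ∑-mono-≤ {zero}  f≤g = ℚ.≤-refl
  ∑-mono-≤ {suc n} f≤g = ℚ.+-mono-≤ (f≤g zero) (∑-mono-≤ λ i → f≤g (suc i))

  ∑-zero : ∀ {n} {f : Fin n → ℚ} → (∀ i → f i ≡ 0ℚ) → ∑ f ≡ 0ℚ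
  ∑-zero {n} f≡0 = trans (∑-cong f≡0) (sum-replicate-zero n)

  0≤∑ : ∀ {n} {f : Fin n → ℚ} → (∀ i → 0ℚ ≤ f i) → 0ℚ ≤ ∑ f
  0≤∑ {n} {f} 0≤f = subst (_≤ ∑ f) (sum-replicate-zero n) (∑-mono-≤ 0≤f)

  ∑-const : ∀ n c → ∑ {n} (λ _ → c) ≡ Q n * c
  ∑-const zero    c = sym (ℚ.*-zeroˡ c)
  ∑-const (suc n) c = trans (cong (c +_) (∑-const n c))
    (trans (e (Q n) c) (cong (_* c) (sym (Q-suc n))))
    where
    e : ∀ m c → c + m * c ≡ (1ℚ + m) * c
    e = solve-∀ ℚ-ring

  ≤∑ : ∀ {n} {f : Fin n → ℚ} → (∀ i → 0ℚ ≤ f i) → ∀ i → f i ≤ ∑ f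
  ≤∑ {suc n} {f} 0≤f zero    = subst (_≤ ∑ f) (ℚ.+-identityʳ (f zero))
    (ℚ.+-monoʳ-≤ (f zero) (0≤∑ λ i → 0≤f (suc i)))
  ≤∑ {suc n} {f} 0≤f (suc i) = subst (_≤ ∑ f) (ℚ.+-identityˡ (f (suc i)))
    (ℚ.+-mono-≤ (0≤f zero) (≤∑ (λ i → 0≤f (suc i)) i))

  ∑-pos⇒∃ : ∀ {n} {f : Fin n → ℚ} → 0ℚ < ∑ f → ∃[ i ] 0ℚ < f i
  ∑-pos⇒∃ {zero}  0<0 = contradiction 0<0 (ℚ.<-irrefl refl)
  ∑-pos⇒∃ {suc n} {f} 0<Σ with 0ℚ ℚ.<? f zero
  ... | yes 0<f₀ = zero , 0<f₀
  ... | no  0≮f₀ =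
    let i , 0<fᵢ = ∑-pos⇒∃ (ℚ.<-≤-trans 0<Σ (subst (∑ f ≤_) (ℚ.+-identityˡ _)
                     (ℚ.+-monoˡ-≤ _ (ℚ.≮⇒≥ 0≮f₀))))
    in suc i , 0<fᵢ

  ∑-δ : ∀ {n} (f : Fin n → ℚ) j → ∑ (λ i → δ i j * f i) ≡ f j
  ∑-δ {suc n} f zero = trans (cong₂ _+_ (ℚ.*-identityˡ (f zero)) (∑-zero λ i → ℚ.*-zeroˡ (f (suc i))))
      (ℚ.+-identityʳ (f zero))
  ∑-δ {suc n} f (suc j) = trans (cong₂ _+_ (ℚ.*-zeroˡ (f zero))
      (trans (∑-cong λ i → cong (_* f (suc i)) (δ-suc i j)) (∑-δ (λ i → f (suc i)) j)))
      (ℚ.+-identityˡ (f (suc j)))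

  ∣tabulate∣ : ∀ {n} (σ : Fin n → Bool) → Q ∣ tabulate σ ∣ ≡ ∑ (λ i → 𝟙 (σ i))
  ∣tabulate∣ {zero}  σ = refl
  ∣tabulate∣ {suc n} σ with σ zero
  ... | true  = trans (Q-suc ∣ tabulate (λ i → σ (suc i)) ∣) (cong (1ℚ +_) (∣tabulate∣ (λ i → σ (suc i))))
  ... | false = trans (∣tabulate∣ (λ i → σ (suc i))) (sym (ℚ.+-identityˡ _))

tabulate-∩ : ∀ {n} (σ τ : Fin n → Bool) → tabulate σ ∩ tabulate τ ≡ tabulate (λ i → σ i ∧ τ i)
tabulate-∩ {zero}  σ τ = refl
tabulate-∩ {suc n} σ τ = cong ((σ zero ∧ τ zero) ∷ᵥ_) (tabulate-∩ (λ i → σ (suc i)) (λ i → τ (suc i)))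

-- Sums over ordered triples

∑³ : ∀ {n} → (Fin n → Fin n → Fin n → ℚ) → ℚ
∑³ F = ∑ λ x → ∑ λ y → ∑ λ z → F x y z

module _ {n : ℕ} where

  ∑³-cong : {F G : Fin n → Fin n → Fin n → ℚ} → (∀ x y z → F x y z ≡ G x y z) → ∑³ F ≡ ∑³ G
  ∑³-cong F≡G = ∑-cong λ x → ∑-cong λ y → ∑-cong λ z → F≡G x y z

  ∑³-mono-≤ : {F G : Fin n → Fin n → Fin n → ℚ} → (∀ x y z → F x y z ≤ G x y z) → ∑³ F ≤ ∑³ G
  ∑³-mono-≤ F≤G = ∑-mono-≤ λ x → ∑-mono-≤ λ y → ∑-mono-≤ λ z → F≤G x y z

  ∑³-+ : (F G : Fin n → Fin n → Fin n → ℚ) → ∑³ (λ x y z → F x y z + G x y z) ≡ ∑³ F + ∑³ G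
  ∑³-+ F G = trans
    (∑-cong λ x → trans (∑-cong λ y → ∑-+ (F x y) (G x y)) (∑-+ _ _))
    (∑-+ _ _)

  *-∑³ : ∀ c (F : Fin n → Fin n → Fin n → ℚ) → ∑³ (λ x y z → c * F x y z) ≡ c * ∑³ F
  *-∑³ c F = sym (trans (*-∑ c _)
    (∑-cong λ x → trans (*-∑ c _) (∑-cong λ y → *-∑ c (F x y))))

  ∑³-∑ : ∀ {m} (F : Fin m → Fin n → Fin n → Fin n → ℚ) →
    ∑³ (λ x y z → ∑ λ i → F i x y z) ≡ ∑ (λ i → ∑³ (F i))
  ∑³-∑ F = trans (∑-cong λ x → trans (∑-cong λ y → ∑-swap λ z i → F i x y z) (∑-swap λ y i → ∑ λ z → F i x y z))
    (∑-swap λ x i → ∑ λ y → ∑ λ z → F i x y z)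

  ∑³-swap₁₂ : (F : Fin n → Fin n → Fin n → ℚ) → ∑³ F ≡ ∑³ (λ x y z → F y x z)
  ∑³-swap₁₂ F = ∑-swap λ x y → ∑ λ z → F x y z

  ∑³-swap₂₃ : (F : Fin n → Fin n → Fin n → ℚ) → ∑³ F ≡ ∑³ (λ x y z → F x z y)
  ∑³-swap₂₃ F = ∑-cong λ x → ∑-swap λ y z → F x y z

codeg : ∀ {n} → (Fin n → Fin n → Bool) → Fin n → Fin n → ℚ
codeg α u v = ∑ λ w → 𝟙 (α u w) * 𝟙 (α v w)

-- 𝔼 sums over the ordered triangles of the graph α and is not normalised: 𝔼 1 = #tri.
module Triangles {n : ℕ} (α : Fin n → Fin n → Bool)
  (α-sym : ∀ u v → α u v ≡ α v u) (α-irrefl : ∀ u → α u u ≡ false) where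

  a : Fin n → Fin n → ℚ
  a u v = 𝟙 (α u v)

  a-sym : ∀ u v → a u v ≡ a v u
  a-sym u v = cong 𝟙 (α-sym u v)

  c : Fin n → Fin n → ℚ
  c = codeg α

  tri : Fin n → Fin n → Fin n → Bool
  tri x y z = α x y ∧ (α y z ∧ α x z)

  wt : Fin n → Fin n → Fin n → ℚ
  wt x y z = 𝟙 (tri x y z)

  𝔼 : (Fin n → Fin n → Fin n → ℚ) → ℚ
  𝔼 F = ∑³ λ x y z → wt x y z * F x y z

  #tri : ℚ
  #tri = 𝔼 λ _ _ _ → 1ℚ

  wt≡ : ∀ x y z → wt x y z ≡ a x y * (a y z * a x z)
  wt≡ x y z = trans (𝟙-∧ (α x y) _) (cong (a x y *_) (𝟙-∧ (α y z) (α x z)))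

  wt₁₂ : ∀ x y z → wt x y z ≡ wt y x z
  wt₁₂ x y z = trans (wt≡ x y z) (trans (cong₂ _*_ (a-sym x y) (ℚ.*-comm (a y z) (a x z))) (sym (wt≡ y x z)))

  wt₂₃ : ∀ x y z → wt x y z ≡ wt x z y
  wt₂₃ x y z = trans (wt≡ x y z) (trans (cong (λ t → a x y * (t * a x z)) (a-sym y z))
    (trans (e (a x y) (a z y) (a x z)) (sym (wt≡ x z y))))
    where
    e : ∀ p q r → p * (q * r) ≡ r * (q * p)
    e = solve-∀ ℚ-ring

  𝔼-cong : ∀ {F G} → (∀ x y z → F x y z ≡ G x y z) → 𝔼 F ≡ 𝔼 G
  𝔼-cong F≡G = ∑³-cong λ x y z → cong (wt x y z *_) (F≡G x y z)

  𝔼-mono-≤ : ∀ {F G} → (∀ x y z → tri x y z ≡ true → F x y z ≤ G x y z) → 𝔼 F ≤ 𝔼 G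
  𝔼-mono-≤ {F} {G} F≤G = ∑³-mono-≤ go
    where
    go : ∀ x y z → wt x y z * F x y z ≤ wt x y z * G x y z
    go x y z with tri x y z in eq
    ... | true  = subst₂ _≤_ (sym (ℚ.*-identityˡ (F x y z))) (sym (ℚ.*-identityˡ (G x y z))) (F≤G x y z eq)
    ... | false = subst₂ _≤_ (sym (ℚ.*-zeroˡ (F x y z))) (sym (ℚ.*-zeroˡ (G x y z))) ℚ.≤-refl

  𝔼-+ : ∀ F G → 𝔼 (λ x y z → F x y z + G x y z) ≡ 𝔼 F + 𝔼 G
  𝔼-+ F G = trans (∑³-cong λ x y z → ℚ.*-distribˡ-+ (wt x y z) (F x y z) (G x y z)) (∑³-+ _ _)

  𝔼-* : ∀ c F → 𝔼 (λ x y z → c * F x y z) ≡ c * 𝔼 F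
  𝔼-* c F = trans (∑³-cong λ x y z → e (wt x y z) c (F x y z)) (*-∑³ c _)
    where
    e : ∀ p q r → p * (q * r) ≡ q * (p * r)
    e = solve-∀ ℚ-ring

  𝔼-const : ∀ c → 𝔼 (λ _ _ _ → c) ≡ c * #tri
  𝔼-const c = trans (𝔼-cong λ _ _ _ → sym (ℚ.*-identityʳ c)) (𝔼-* c _)

  𝔼-∑ : ∀ {m} (F : Fin m → Fin n → Fin n → Fin n → ℚ) →
    𝔼 (λ x y z → ∑ λ i → F i x y z) ≡ ∑ (λ i → 𝔼 (F i))
  𝔼-∑ F = trans (∑³-cong λ x y z → *-∑ (wt x y z) (λ i → F i x y z))
    (∑³-∑ λ i x y z → wt x y z * F i x y z)

  𝔼-swap₁₂ : ∀ F → 𝔼 F ≡ 𝔼 (λ x y z → F y x z)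
  𝔼-swap₁₂ F = trans (∑³-swap₁₂ λ x y z → wt x y z * F x y z) (∑³-cong λ x y z → cong (_* F y x z) (wt₁₂ y x z))

  𝔼-swap₂₃ : ∀ F → 𝔼 F ≡ 𝔼 (λ x y z → F x z y)
  𝔼-swap₂₃ F = trans (∑³-swap₂₃ λ x y z → wt x y z * F x y z) (∑³-cong λ x y z → cong (_* F x z y) (wt₂₃ x z y))

  𝔼-pos⇒∃ : ∀ F → 0ℚ < 𝔼 F → ∃[ x ] ∃[ y ] ∃[ z ] tri x y z ≡ true × 0ℚ < F x y z
  𝔼-pos⇒∃ F 0<𝔼 =
    let x , 0<₁ = ∑-pos⇒∃ 0<𝔼
        y , 0<₂ = ∑-pos⇒∃ 0<₁
        z , 0<₃ = ∑-pos⇒∃ 0<₂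
        t , 0<F = 0<𝟙*⇒ (tri x y z) 0<₃
    in x , y , z , t , 0<F

  on-edge : Fin n → Fin n → ℚ
  on-edge u v = 𝔼 λ x y z → δ x u * δ y v

  on-edge≡ : ∀ u v → on-edge u v ≡ a u v * c u v
  on-edge≡ u v = begin
    (∑ λ x → ∑ λ y → ∑ λ (z : Fin n) → wt x y z * (δ x u * δ y v))
      ≡⟨ (∑-cong λ x → trans (∑-cong λ y → trans (∑-cong λ z → e (wt x y z) (δ x u) (δ y v))
          (sym (*-∑ (δ x u) (λ z → δ y v * wt x y z))))
            (sym (*-∑ (δ x u) (λ y → ∑ λ z → δ y v * wt x y z)))) ⟩
    (∑ λ x → δ x u * ∑ λ y → ∑ λ z → δ y v * wt x y z)
      ≡⟨ ∑-δ (λ x → ∑ λ y → ∑ λ z → δ y v * wt x y z) u ⟩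
    (∑ λ y → ∑ λ z → δ y v * wt u y z)
      ≡⟨ (∑-cong λ y → sym (*-∑ (δ y v) (wt u y))) ⟩
    (∑ λ y → δ y v * ∑ λ z → wt u y z)
      ≡⟨ ∑-δ (λ y → ∑ λ z → wt u y z) v ⟩
    (∑ λ z → wt u v z)
      ≡⟨ (∑-cong λ z → trans (wt≡ u v z) (cong (a u v *_) (ℚ.*-comm (a v z) (a u z)))) ⟩
    (∑ λ z → a u v * (a u z * a v z))
      ≡⟨ sym (*-∑ (a u v) _) ⟩
    a u v * c u v ∎
    where
    open ≡-Reasoning
    e : ∀ p q r → p * (q * r) ≡ q * (r * p)
    e = solve-∀ ℚ-ring

  -- Being a corner, written additively so that `𝔼` can be expanded over the positions; on a
  -- triangle it takes the values 0 and 1 because the corners differ (`corner≡`).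
  corners : Fin n → Fin n → Fin n → Fin n → ℚ
  corners x y z u = δ x u + δ y u + δ z u

  private
    δδ≡0 : ∀ {u v : Fin n} → u ≢ v → ∀ x → δ x u * δ x v ≡ 0ℚ
    δδ≡0 {u} {v} u≢v x with x Fin.≟ u | x Fin.≟ v
    ... | yes refl | yes refl = contradiction refl u≢v
    ... | yes _    | no _     = refl
    ... | no _     | yes _    = refl
    ... | no _     | no _     = refl

    expand : ∀ x x' y y' z z' → (x + y + z) * (x' + y' + z') ≡
      x * y' + y * x' + x * z' + y * z' + z * x' + z * y' + (x * x' + y * y' + z * z')
    expand = solve-∀ ℚ-ring

  -- u and v can occupy two of the three corners in six ordered ways, each equivalent to `on-edge`
  -- by symmetry of `wt`; one corner cannot be both.
  𝔼-pair : ∀ {u v} → u ≢ v → 𝔼 (λ x y z → corners x y z u * corners x y z v) ≡ Q 6 * (a u v * c u v)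
  𝔼-pair {u} {v} u≢v = begin
    𝔼 (λ x y z → corners x y z u * corners x y z v)
      ≡⟨ 𝔼-cong (λ x y z → trans (expand (δ x u) (δ x v) (δ y u) (δ y v) (δ z u) (δ z v))
           (trans (cong (s₆ x y z +_) (cong₂ _+_ (cong₂ _+_ (δδ≡0 u≢v x) (δδ≡0 u≢v y)) (δδ≡0 u≢v z)))
             (ℚ.+-identityʳ (s₆ x y z)))) ⟩
    𝔼 s₆
      ≡⟨ trans (𝔼-+ _ f₆) (cong (_+ 𝔼 f₆) (trans (𝔼-+ _ f₅)
          (cong (_+ 𝔼 f₅) (trans (𝔼-+ _ f₄) (cong (_+ 𝔼 f₄)
          (trans (𝔼-+ _ f₃) (cong (_+ 𝔼 f₃) (𝔼-+ f₁ f₂)))))))) ⟩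
    𝔼 f₁ + 𝔼 f₂ + 𝔼 f₃ + 𝔼 f₄ + 𝔼 f₅ + 𝔼 f₆
      ≡⟨ cong₂ _+_ (cong₂ _+_ (cong₂ _+_ (cong₂ _+_ (cong₂ _+_ (refl {x = p}) e₂) e₃) e₄) e₅) e₆ ⟩
    p + p + p + p + p + p ≡⟨ six p ⟩
    Q 6 * p ≡⟨ cong (Q 6 *_) (on-edge≡ u v) ⟩
    Q 6 * (a u v * c u v) ∎
    where
    open ≡-Reasoning
    p = on-edge u v
    f₁ f₂ f₃ f₄ f₅ f₆ s₆ : Fin n → Fin n → Fin n → ℚ
    f₁ x y z = δ x u * δ y v
    f₂ x y z = δ y u * δ x v
    f₃ x y z = δ x u * δ z v
    f₄ x y z = δ y u * δ z v
    f₅ x y z = δ z u * δ x v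
    f₆ x y z = δ z u * δ y v
    s₆ x y z = f₁ x y z + f₂ x y z + f₃ x y z + f₄ x y z + f₅ x y z + f₆ x y z
    e₂ : 𝔼 f₂ ≡ p
    e₂ = 𝔼-swap₁₂ f₂
    e₃ : 𝔼 f₃ ≡ p
    e₃ = 𝔼-swap₂₃ f₃
    e₄ : 𝔼 f₄ ≡ p
    e₄ = trans (𝔼-swap₁₂ f₄) e₃
    e₅ : 𝔼 f₅ ≡ p
    e₅ = trans (𝔼-swap₂₃ f₅) e₂
    e₆ : 𝔼 f₆ ≡ p
    e₆ = trans (𝔼-swap₂₃ f₆) e₄
    six : ∀ p → p + p + p + p + p + p ≡ Q 6 * p
    six = solve-∀ ℚ-ring

-- Codegrees lost when a triangle is removed

corner? : ∀ {n} → Fin n → Fin n → Fin n → Fin n → Bool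
corner? x y z u = does (x Fin.≟ u) ∨ (does (y Fin.≟ u) ∨ does (z Fin.≟ u))

remove : ∀ {n} → (Fin n → Bool) → (Fin n → Fin n → Bool) → Fin n → Fin n → Bool
remove σ α u v = α u v ∧ not (σ u ∧ σ v)

private
  ∀-Bool? : {P : Bool → Set} → (∀ b → Dec (P b)) → Dec (∀ b → P b)
  ∀-Bool? P? with P? true | P? false
  ... | yes p | yes q = yes λ { true → p ; false → q }
  ... | no ¬p | _     = no λ f → ¬p (f true)
  ... | yes _ | no ¬q = no λ f → ¬q (f false)

  -- What a third vertex w contributes to the codegree lost by u and v: `A` and `B` say that w is
  -- adjacent to u and to v, and `p`, `q`, `r` that u, v, w are corners of the removed triangle.
  Loss : (A B p q r : Bool) → ℚ
  Loss A B p q r = 𝟙 A * 𝟙 B - 𝟙 (A ∧ not (p ∧ r)) * 𝟙 (B ∧ not (q ∧ r))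

  -- The removals of the edges uw and vw are counted separately, so the path through w is counted
  -- twice when u, v, w are all corners.
  Hit : (A B p q r : Bool) → ℚ
  Hit A B p q r = 𝟙 A * 𝟙 B * (𝟙 p * 𝟙 r + 𝟙 q * 𝟙 r)

  0≤Loss : ∀ A B p q r → 0ℚ ≤ Loss A B p q r
  0≤Loss = toWitness {a? = ∀-Bool? λ A → ∀-Bool? λ B → ∀-Bool? λ p → ∀-Bool? λ q → ∀-Bool? λ r →
    0ℚ ℚ.≤? Loss A B p q r} _

  Loss≤corner : ∀ A B p q r → Loss A B p q r ≤ 𝟙 r
  Loss≤corner = toWitness {a? = ∀-Bool? λ A → ∀-Bool? λ B → ∀-Bool? λ p → ∀-Bool? λ q → ∀-Bool? λ r →
    Loss A B p q r ℚ.≤? 𝟙 r} _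

  Loss≤Hit : ∀ A B p q r → Loss A B p q r ≤ Hit A B p q r
  Loss≤Hit = toWitness {a? = ∀-Bool? λ A → ∀-Bool? λ B → ∀-Bool? λ p → ∀-Bool? λ q → ∀-Bool? λ r →
    Loss A B p q r ℚ.≤? Hit A B p q r} _

  Hit≤Loss : ∀ A B p q r → Hit A B p q r ≤ Loss A B p q r + 𝟙 p * 𝟙 q * 𝟙 r
  Hit≤Loss = toWitness {a? = ∀-Bool? λ A → ∀-Bool? λ B → ∀-Bool? λ p → ∀-Bool? λ q → ∀-Bool? λ r →
    Hit A B p q r ℚ.≤? Loss A B p q r + 𝟙 p * 𝟙 q * 𝟙 r} _

  𝟙-∨ : ∀ p q → p ∧ q ≡ false → 𝟙 (p ∨ q) ≡ 𝟙 p + 𝟙 q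
  𝟙-∨ true  false _ = refl
  𝟙-∨ false true  _ = refl
  𝟙-∨ false false _ = refl

loss : ∀ {n} → (Fin n → Bool) → (Fin n → Fin n → Bool) → Fin n → Fin n → ℚ
loss σ α u v = codeg α u v - codeg (remove σ α) u v

module Loss {n : ℕ} (α : Fin n → Fin n → Bool)
  (α-sym : ∀ u v → α u v ≡ α v u) (α-irrefl : ∀ u → α u u ≡ false) where

  open Triangles α α-sym α-irrefl

  c≤n : ∀ u v → c u v ≤ Q n
  c≤n u v = subst (c u v ≤_) (trans (∑-const n 1ℚ) (ℚ.*-identityʳ (Q n)))
    (∑-mono-≤ λ w → *-mono-≤ (0≤𝟙 (α u w)) (0≤𝟙 (α v w)) (𝟙≤1 (α u w)) (𝟙≤1 (α v w)))

  0≤c : ∀ u v → 0ℚ ≤ c u v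
  0≤c u v = 0≤∑ λ w → 0≤𝟙 (α u w) ⊗ 0≤𝟙 (α v w)

  tri⇒ : ∀ {x y z} → tri x y z ≡ true → α x y ≡ true × α y z ≡ true × α x z ≡ true
  tri⇒ {x} {y} {z} t with α x y | α y z | α x z
  tri⇒ refl | true | true | true = refl , refl , refl

  adj⇒≢ : ∀ {u v} → α u v ≡ true → u ≢ v
  adj⇒≢ {u} αuv refl with trans (sym αuv) (α-irrefl u)
  ... | ()

  corner≡ : ∀ {x y z} → tri x y z ≡ true → ∀ u → 𝟙 (corner? x y z u) ≡ corners x y z u
  corner≡ {x} {y} {z} t u with tri⇒ t
  ... | xy , yz , xz = trans
    (𝟙-∨ (does (x Fin.≟ u)) _ (disj₂ (x Fin.≟ u) (y Fin.≟ u) (z Fin.≟ u)))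
    (trans (cong (δ x u +_) (𝟙-∨ (does (y Fin.≟ u)) _ (disj₁ (y Fin.≟ u) (z Fin.≟ u))))
      (sym (ℚ.+-assoc (δ x u) (δ y u) (δ z u))))
    where
    disj₁ : (p : Dec (y ≡ u)) (q : Dec (z ≡ u)) → does p ∧ does q ≡ false
    disj₁ (yes refl) (yes refl) = contradiction refl (adj⇒≢ yz)
    disj₁ (yes _) (no _) = refl
    disj₁ (no _)  _      = refl
    disj₂ : (p : Dec (x ≡ u)) (q : Dec (y ≡ u)) (r : Dec (z ≡ u)) → does p ∧ (does q ∨ does r) ≡ false
    disj₂ (no _) _ _ = refl
    disj₂ (yes refl) (yes refl) _ = contradiction refl (adj⇒≢ xy)
    disj₂ (yes refl) (no _) (yes refl) = contradiction refl (adj⇒≢ xz)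
    disj₂ (yes refl) (no _) (no _) = refl

  ∑δ≡1 : ∀ (x : Fin n) → ∑ (λ u → δ x u) ≡ 1ℚ
  ∑δ≡1 x = trans (∑-cong λ u → trans (δ-sym x u) (sym (ℚ.*-identityʳ (δ u x)))) (∑-δ (λ _ → 1ℚ) x)

  ∑corner : ∀ {x y z} → tri x y z ≡ true → ∑ (λ u → 𝟙 (corner? x y z u)) ≡ Q 3
  ∑corner {x} {y} {z} t = trans (∑-cong (corner≡ t))
    (trans (∑-+ _ (δ z)) (cong₂ _+_ (trans (∑-+ (δ x) (δ y)) (cong₂ _+_ (∑δ≡1 x) (∑δ≡1 y))) (∑δ≡1 z)))

  ℓ : Fin n → Fin n → Fin n → Fin n → Fin n → ℚ
  ℓ u v x y z = loss (corner? x y z) α u v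

  hit : Fin n → Fin n → Fin n → Fin n → Fin n → ℚ
  hit u v x y z = ∑ λ w → a u w * a v w * (s u * s w + s v * s w)
    where
    s : Fin n → ℚ
    s = corners x y z

  private
    loss≡ : ∀ σ u v → loss σ α u v ≡ ∑ (λ w → Loss (α u w) (α v w) (σ u) (σ v) (σ w))
    loss≡ σ u v = trans (cong (c u v +_) (trans (neg (codeg (remove σ α) u v)) (*-∑ (- 1ℚ) _)))
      (trans (sym (∑-+ _ _)) (∑-cong λ w → e (a u w * a v w) (𝟙 (remove σ α u w) * 𝟙 (remove σ α v w))))
      where
      neg : ∀ x → - x ≡ - 1ℚ * x
      neg = solve-∀ ℚ-ring
      e : ∀ x y → x + - 1ℚ * y ≡ x - y
      e = solve-∀ ℚ-ring

    hit≡ : ∀ {x y z} → tri x y z ≡ true → ∀ u v → hit u v x y z ≡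
      ∑ (λ w → Hit (α u w) (α v w) (corner? x y z u) (corner? x y z v) (corner? x y z w))
    hit≡ t u v = ∑-cong λ w → cong (a u w * a v w *_)
      (sym (cong₂ _+_ (cong₂ _*_ (corner≡ t u) (corner≡ t w)) (cong₂ _*_ (corner≡ t v) (corner≡ t w))))

  0≤ℓ : ∀ u v x y z → 0ℚ ≤ ℓ u v x y z
  0≤ℓ u v x y z = subst (0ℚ ≤_) (sym (loss≡ (corner? x y z) u v))
      (0≤∑ λ w → 0≤Loss (α u w) (α v w) (corner? x y z u) (corner? x y z v) (corner? x y z w))

  ℓ≤3 : ∀ u v {x y z} → tri x y z ≡ true → ℓ u v x y z ≤ Q 3
  ℓ≤3 u v {x} {y} {z} t = subst₂ _≤_ (sym (loss≡ (corner? x y z) u v)) (∑corner t)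
    (∑-mono-≤ λ w → Loss≤corner (α u w) (α v w) (corner? x y z u) (corner? x y z v) (corner? x y z w))

  ℓ≤hit : ∀ u v {x y z} → tri x y z ≡ true → ℓ u v x y z ≤ hit u v x y z
  ℓ≤hit u v {x} {y} {z} t = subst₂ _≤_ (sym (loss≡ (corner? x y z) u v)) (sym (hit≡ t u v))
    (∑-mono-≤ λ w → Loss≤Hit (α u w) (α v w) (corner? x y z u) (corner? x y z v) (corner? x y z w))

  hit≤ℓ : ∀ u v {x y z} → tri x y z ≡ true →
    hit u v x y z ≤ ℓ u v x y z + Q 3 * (corners x y z u * corners x y z v)
  hit≤ℓ u v {x} {y} {z} t = subst₂ _≤_ (sym (hit≡ t u v))
    (trans (∑-+ _ _) (cong₂ _+_ (sym (loss≡ (corner? x y z) u v))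
      (trans (sym (*-∑ (𝟙 (corner? x y z u) * 𝟙 (corner? x y z v)) _))
        (trans (ℚ.*-comm (𝟙 (corner? x y z u) * 𝟙 (corner? x y z v)) _)
          (cong₂ _*_ (∑corner t) (cong₂ _*_ (corner≡ t u) (corner≡ t v)))))))
    (∑-mono-≤ λ w → Hit≤Loss (α u w) (α v w) (corner? x y z u) (corner? x y z v) (corner? x y z w))

  -- For an edge uw, `c u w` counts the triangles on it, so this counts the ways in which a triangle
  -- can break a path u-w-v. With six orderings of each triangle it gives the mean of `hit`.
  drift : Fin n → Fin n → ℚ
  drift u v = ∑ λ w → a u w * a v w * (c u w + c v w)

  𝔼-hit : ∀ u v → 𝔼 (hit u v) ≡ Q 6 * drift u v
  𝔼-hit u v = begin
    𝔼 (hit u v)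
      ≡⟨ 𝔼-∑ (λ w x y z → a u w * a v w * (corners x y z u * corners x y z w + corners x y z v * corners x
          y z w)) ⟩
    ∑ (λ w → 𝔼 λ x y z → a u w * a v w * (corners x y z u * corners x y z w + corners x y z v * corners x
        y z w))
      ≡⟨ (∑-cong λ w → trans (𝔼-* (a u w * a v w) _) (trans (cong (a u w * a v w *_) (𝔼-+ _ _)) (pt w))) ⟩
    ∑ (λ w → Q 6 * (a u w * a v w * (c u w + c v w)))
      ≡⟨ sym (*-∑ (Q 6) _) ⟩
    Q 6 * drift u v ∎
    where
    open ≡-Reasoning
    pair : Fin n → Fin n → ℚ
    pair u w = 𝔼 λ x y z → corners x y z u * corners x y z w
    e₁ : ∀ p q r s → p * q * (r + s) ≡ q * (p * r) + p * (q * s)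
    e₁ = solve-∀ ℚ-ring
    e₂ : ∀ p q r s → q * (Q 6 * (p * r)) + p * (Q 6 * (q * s)) ≡ Q 6 * (p * q * (r + s))
    e₂ = solve-∀ ℚ-ring
    e₄ : ∀ q r → 0ℚ * q ≡ Q 6 * (0ℚ * r)
    e₄ = solve-∀ ℚ-ring
    -- `𝔼-pair` needs u ≢ w, which adjacency supplies; a non-adjacent w is annihilated by the factor
    -- `a u w`.
    edge : ∀ u w → a u w * pair u w ≡ Q 6 * (a u w * c u w)
    edge u w with α u w in αuw
    ... | false = e₄ (pair u w) (c u w)
    ... | true  = trans (ℚ.*-identityˡ (pair u w))
        (subst (λ p → pair u w ≡ Q 6 * (𝟙 p * c u w)) αuw (𝔼-pair (adj⇒≢ αuw)))
    pt : ∀ w → a u w * a v w * (pair u w + pair v w) ≡ Q 6 * (a u w * a v w * (c u w + c v w))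
    pt w = trans (e₁ (a u w) (a v w) (pair u w) (pair v w))
      (trans (cong₂ _+_ (cong (a v w *_) (edge u w)) (cong (a u w *_) (edge v w)))
        (e₂ (a u w) (a v w) (c u w) (c v w)))

  𝔼ℓ≤ : ∀ u v → 𝔼 (ℓ u v) ≤ Q 6 * drift u v
  𝔼ℓ≤ u v = subst (𝔼 (ℓ u v) ≤_) (𝔼-hit u v) (𝔼-mono-≤ λ x y z t → ℓ≤hit u v t)

  -- Double counting happens only in triangles through both u and v. There are 6 `c u v` ordered
  -- ones if u and v are adjacent, and each costs at most 3, the number of corners: hence 18.
  ≤𝔼ℓ : ∀ {u v} → u ≢ v → Q 6 * drift u v ≤ 𝔼 (ℓ u v) + Q 18 * c u v
  ≤𝔼ℓ {u} {v} u≢v = ℚ.≤-trans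
    (subst₂ _≤_ (𝔼-hit u v) (trans (𝔼-+ _ _) (cong (𝔼 (ℓ u v) +_)
        (trans (𝔼-* (Q 3) _) (cong (Q 3 *_) (𝔼-pair u≢v)))))
      (𝔼-mono-≤ λ x y z t → hit≤ℓ u v t))
    (ℚ.+-monoʳ-≤ (𝔼 (ℓ u v)) (≤-by (lit 18 ⊗ (gap (𝟙≤1 (α u v)) ⊗ 0≤c u v)) (e (a u v) (c u v))))
    where
    e : ∀ p r → Q 18 * r - Q 3 * (Q 6 * (p * r)) ≡ Q 18 * ((1ℚ - p) * r)
    e = solve-∀ ℚ-ring

  drift≤ : ∀ {u v U} → (∀ {u w} → u ≢ w → c u w ≤ U) → drift u v ≤ c u v * (Q 2 * U)
  drift≤ {u} {v} {U} c≤U = subst (drift u v ≤_) (trans (∑-cong λ w → ℚ.*-comm (a u w * a v w) _)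
      (trans (sym (*-∑ (Q 2 * U) _)) (ℚ.*-comm (Q 2 * U) (c u v)))) (∑-mono-≤ pt)
    where
    e : ∀ U x y → Q 2 * U - (x + y) ≡ (U - x) + (U - y)
    e = solve-∀ ℚ-ring
    pt : ∀ w → a u w * a v w * (c u w + c v w) ≤ a u w * a v w * (Q 2 * U)
    pt w with α u w in αuw | α v w in αvw
    ... | false | false = ℚ.≤-reflexive (trans (ℚ.*-zeroˡ (c u w + c v w)) (sym (ℚ.*-zeroˡ (Q 2 * U))))
    ... | false | true  = ℚ.≤-reflexive (trans (ℚ.*-zeroˡ (c u w + c v w)) (sym (ℚ.*-zeroˡ (Q 2 * U))))
    ... | true  | false = ℚ.≤-reflexive (trans (ℚ.*-zeroˡ (c u w + c v w)) (sym (ℚ.*-zeroˡ (Q 2 * U))))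
    ... | true  | true  = *-monoˡ-≤ 1ℚ {c u w + c v w} {Q 2 * U} 0≤1
        (≤-by (gap (c≤U (adj⇒≢ αuw)) ⊕ gap (c≤U (adj⇒≢ αvw))) (e U (c u w) (c v w)))

  ≤drift : ∀ {u v l} → (∀ {u w} → u ≢ w → l ≤ c u w) → c u v * (Q 2 * l) ≤ drift u v
  ≤drift {u} {v} {l} l≤c = subst (_≤ drift u v) (trans (∑-cong λ w → ℚ.*-comm (a u w * a v w) _)
      (trans (sym (*-∑ (Q 2 * l) _)) (ℚ.*-comm (Q 2 * l) (c u v)))) (∑-mono-≤ pt)
    where
    e : ∀ l x y → (x + y) - Q 2 * l ≡ (x - l) + (y - l)
    e = solve-∀ ℚ-ring
    pt : ∀ w → a u w * a v w * (Q 2 * l) ≤ a u w * a v w * (c u w + c v w)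
    pt w with α u w in αuw | α v w in αvw
    ... | false | false = ℚ.≤-reflexive (trans (ℚ.*-zeroˡ (Q 2 * l)) (sym (ℚ.*-zeroˡ (c u w + c v w))))
    ... | false | true  = ℚ.≤-reflexive (trans (ℚ.*-zeroˡ (Q 2 * l)) (sym (ℚ.*-zeroˡ (c u w + c v w))))
    ... | true  | false = ℚ.≤-reflexive (trans (ℚ.*-zeroˡ (Q 2 * l)) (sym (ℚ.*-zeroˡ (c u w + c v w))))
    ... | true  | true  = *-monoˡ-≤ 1ℚ {Q 2 * l} {c u w + c v w} 0≤1
        (≤-by (gap (l≤c (adj⇒≢ αuw)) ⊕ gap (l≤c (adj⇒≢ αvw))) (e l (c u w) (c v w)))

-- The potential and one removal step

ψ⁸ : ℚ → ℚ
ψ⁸ x = (x ⁺) ⁸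

-- The diagonal is kept out of the potential: there the codegree is a degree and follows another
-- trajectory.
distinct : ∀ {n} → Fin n → Fin n → ℚ
distinct u v = 𝟙 (not (does (u Fin.≟ v)))

dev : ∀ {n} → (Fin n → Fin n → Bool) → (M D : ℚ) → Fin n → Fin n → ℚ
dev α M D u v = ψ⁸ (codeg α u v - (M + D)) + ψ⁸ (M - D - codeg α u v)

Φ : ∀ {n} → (Fin n → Fin n → Bool) → (M D : ℚ) → ℚ
Φ α M D = ∑ λ u → ∑ λ v → distinct u v * dev α M D u v

0≤dev : ∀ {n} (α : Fin n → Fin n → Bool) M D u v → 0ℚ ≤ dev α M D u v
0≤dev α M D u v = 0≤⁸ ((codeg α u v - (M + D)) ⁺) ⊕ 0≤⁸ ((M - D - codeg α u v) ⁺)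

distinct-mono : ∀ {n} (u v : Fin n) {p q} → (u ≢ v → p ≤ q) → distinct u v * p ≤ distinct u v * q
distinct-mono u v {p} {q} p≤q with u Fin.≟ v
... | yes _   = ℚ.≤-reflexive (trans (ℚ.*-zeroˡ p) (sym (ℚ.*-zeroˡ q)))
... | no  u≢v = *-monoˡ-≤ 1ℚ 0≤1 (p≤q u≢v)

∑∑distinct≤ : ∀ n → (∑ λ (u : Fin n) → ∑ λ v → distinct u v) ≤ Q n * Q n
∑∑distinct≤ n = subst ((∑ λ (u : Fin n) → ∑ λ v → distinct u v) ≤_) (∑-const n (Q n))
  (∑-mono-≤ λ u → subst ((∑ λ v → distinct u v) ≤_) (trans (∑-const n 1ℚ) (ℚ.*-identityʳ (Q n)))
    (∑-mono-≤ λ v → 𝟙≤1 (not (does (u Fin.≟ v)))))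

-- `small-step` limits the movement of an envelope edge to 1; with a loss of at most 3 this gives
-- the step bound 4 of the Taylor estimate. `≤κ` collects what the drift leaves unpaid: 2D² from the
-- product of the two errors, 2η(M + D) from the tolerance, and 3(M + D) from triangles through both
-- vertices. `3≤` keeps the corrected drift monotone in the codegree.
record Scales (n : ℕ) (M D h κ η Θ ψ : ℚ) : Set where
  field
    0≤M : 0ℚ ≤ M
    M≤ : M ≤ Q 2 * Q n
    0≤D : 0ℚ ≤ D
    0≤h : 0ℚ ≤ h
    0≤κ : 0ℚ ≤ κ
    κ≤ : κ ≤ Q n * Q n
    0≤η : 0ℚ ≤ η
    small-step : h * (Q 2 * (M * M) + κ) ≤ 1ℚ
    3≤ : Q 3 ≤ Q 2 * (M - D - η)
    ≤κ : Q 2 * (D * D) + (Q 2 * η + Q 3) * (M + D) ≤ κ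
    16≤Θ : Q 16 ≤ Θ
    0≤ψ : 0ℚ ≤ ψ
    Θψ≡1 : Θ * ψ ≡ 1ℚ

module Step {n : ℕ} (α : Fin n → Fin n → Bool)
  (α-sym : ∀ u v → α u v ≡ α v u) (α-irrefl : ∀ u → α u u ≡ false)
  {M D h κ η Θ ψ : ℚ} (scales : Scales n M D h κ η Θ ψ)
  (h-def : h * Triangles.#tri α α-sym α-irrefl ≡ Q 6)
  (0<#tri : 0ℚ < Triangles.#tri α α-sym α-irrefl)
  (c≤ : ∀ {u v} → u ≢ v → codeg α u v ≤ M + D + η)
  (≤c : ∀ {u v} → u ≢ v → M - D - η ≤ codeg α u v)
  where

  open Triangles α α-sym α-irrefl
  open Loss α α-sym α-irrefl
  open Scales scales

  -- An Euler step of length `h` for M′ = -2M² and D′ = κ.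
  M′ D′ : ℚ
  M′ = M - Q 2 * (M * M) * h
  D′ = D + κ * h

  private
    q = Q n
    0≤q = lit n
    -- A common bound for the change of both deviations of a pair: the lost codegree plus the
    -- movement of the edge.
    t : Fin n → Fin n → Fin n → Fin n → Fin n → ℚ
    t u v x y z = ℓ u v x y z + h * (Q 2 * (M * M) + κ)

    0≤stp : 0ℚ ≤ h * (Q 2 * (M * M) + κ)
    0≤stp = 0≤h ⊗ (lit 2 ⊗ (0≤M ⊗ 0≤M) ⊕ 0≤κ)

    remainder : ℚ → ℚ
    remainder F = Θ * Θ * Θ + ψ * F

    0≤remainder : ∀ {F} → 0ℚ ≤ F → 0ℚ ≤ remainder F
    0≤remainder 0≤F = let 0≤Θ = ℚ.≤-trans (lit 16) 16≤Θ in 0≤Θ ⊗ 0≤Θ ⊗ 0≤Θ ⊕ 0≤ψ ⊗ 0≤F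

    t≤4 : ∀ u v {x y z} → tri x y z ≡ true → t u v x y z ≤ Q 4
    t≤4 u v τ = ℚ.+-mono-≤ (ℓ≤3 u v τ) small-step

    -- The loss contributes at most 6 · 2q² = 12q². The edge movement is constant, so `h-def` turns
    -- its sum over triangles into 6(2M² + κ) ≤ 6 · 9q² = 54q².
    𝔼t≤ : ∀ u v → 𝔼 (t u v) ≤ Q 66 * (q * q)
    𝔼t≤ u v = subst (_≤ Q 66 * (q * q)) (sym (trans (𝔼-+ (ℓ u v) _)
        (cong (𝔼 (ℓ u v) +_) (trans (𝔼-const (h * (Q 2 * (M * M) + κ))) (e₀ h M κ #tri)))))
      (subst (λ z → 𝔼 (ℓ u v) + z * (Q 2 * (M * M) + κ) ≤ Q 66 * (q * q)) (sym h-def)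
        (≤-by (gap (𝔼ℓ≤ u v) ⊕ lit 6 ⊗ gap (drift≤ {u} {v} {q} (λ {u} {w} _ → c≤n u w)) ⊕ lit 12 ⊗ (gap (c≤n u v) ⊗ 0≤q)
            ⊕ lit 12 ⊗ (gap M≤ ⊗ (lit 2 ⊗ 0≤q ⊕ 0≤M)) ⊕ lit 6 ⊗ gap κ≤)
          (e₁ (𝔼 (ℓ u v)) M κ q (drift u v) (c u v))))
      where
      e₀ : ∀ h M κ T → h * (Q 2 * (M * M) + κ) * T ≡ h * T * (Q 2 * (M * M) + κ)
      e₀ = solve-∀ ℚ-ring
      e₁ : ∀ e M κ q d c → Q 66 * (q * q) - (e + Q 6 * (Q 2 * (M * M) + κ)) ≡
        (Q 6 * d - e) + Q 6 * (c * (Q 2 * q) - d) + Q 12 * ((q - c) * q)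
          + Q 12 * ((Q 2 * q - M) * (Q 2 * q + M)) + Q 6 * (q * q - κ)
      e₁ = solve-∀ ℚ-ring

    -- A deviation that exceeds the envelope has non-positive mean drift; the others
    -- contribute nothing at first order.
    average : ∀ u v X (Δ : Fin n → Fin n → Fin n → ℚ) →
      (∀ x y z → Δ x y z ≤ t u v x y z) → (∀ x y z → - t u v x y z ≤ Δ x y z) →
      (0ℚ ≤ X → 𝔼 Δ ≤ 0ℚ) →
      𝔼 (λ x y z → ψ⁸ (X + Δ x y z)) ≤ #tri * ψ⁸ X + Q 473088 * (q * q) * remainder (ψ⁸ X)
    average u v X Δ Δ≤t -t≤Δ drift≤0 = ℚ.≤-trans
      (𝔼-mono-≤ λ x y z τ → ⁺⁸-taylor 16≤Θ 0≤ψ Θψ≡1 X {Δ x y z} {t u v x y z}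
        (0≤ℓ u v x y z ⊕ 0≤stp) (t≤4 u v τ) (Δ≤t x y z) (-t≤Δ x y z))
      (subst (_≤ #tri * ψ⁸ X + Q 473088 * (q * q) * r) (sym expectation)
        -- 7168 = 4 · 1792 comes from the Taylor bound, and 473088 = 66 · 7168 includes the bound on
        -- `𝔼 (t u v)`.
        (≤-by (lit 8 ⊗ first-order ⊕ lit 7168 ⊗ (gap (𝔼t≤ u v) ⊗ 0≤remainder (0≤⁸ (X ⁺))))
          (e₂ #tri (ψ⁸ X) ((X ⁺) ⁷) (𝔼 Δ) (𝔼 (t u v)) r q)))
      where
      r = remainder (ψ⁸ X)
      first-order : 0ℚ ≤ (X ⁺) ⁷ * (0ℚ - 𝔼 Δ)
      first-order with ℚ.≤-total 0ℚ X
      ... | inj₁ 0≤X = (0≤x ⊗ 0≤x ⊗ 0≤x ⊗ 0≤x ⊗ 0≤x ⊗ 0≤x ⊗ 0≤x) ⊗ gap (drift≤0 0≤X)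
        where 0≤x = 0≤x⁺ X
      ... | inj₂ X≤0 = subst (λ y → 0ℚ ≤ y ⁷ * (0ℚ - 𝔼 Δ)) (sym (ℚ.p≤q⇒p⊔q≡q X≤0))
          (ℚ.≤-reflexive (sym (ℚ.*-zeroˡ (0ℚ - 𝔼 Δ))))
      e₄ : ∀ t r → Q 1792 * (Q 4 * t) * r ≡ Q 7168 * r * t
      e₄ = solve-∀ ℚ-ring
      expectation : 𝔼 (λ x y z → ψ⁸ X + Q 8 * (X ⁺) ⁷ * Δ x y z + Q 1792 * (Q 4 * t u v x y z) * r)
        ≡ ψ⁸ X * #tri + Q 8 * (X ⁺) ⁷ * 𝔼 Δ + Q 7168 * r * 𝔼 (t u v)
      expectation = trans (𝔼-+ _ _) (cong₂ _+_
        (trans (𝔼-+ _ _) (cong₂ _+_ (𝔼-const (ψ⁸ X)) (𝔼-* (Q 8 * (X ⁺) ⁷) Δ)))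
        (trans (𝔼-cong λ x y z → e₄ (t u v x y z) r) (𝔼-* (Q 7168 * r) (t u v))))
      e₂ : ∀ T F g e E r q → T * F + Q 473088 * (q * q) * r - (F * T + Q 8 * g * e + Q 7168 * r * E) ≡
        Q 8 * (g * (0ℚ - e)) + Q 7168 * ((Q 66 * (q * q) - E) * r)
      e₂ = solve-∀ ℚ-ring

    shift : ℚ → ℚ → Fin n → Fin n → Fin n → Fin n → Fin n → ℚ
    shift k s u v x y z = k + s * ℓ u v x y z

    𝔼-shift : ∀ k s u v → 𝔼 (shift (k * h) s u v) ≡ Q 6 * k + s * 𝔼 (ℓ u v)
    𝔼-shift k s u v = trans (𝔼-+ _ _) (cong₂ _+_
      (trans (𝔼-const (k * h)) (trans (e k h #tri) (cong (_* k) h-def))) (𝔼-* s (ℓ u v)))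
      where
      e : ∀ k h T → k * h * T ≡ h * T * k
      e = solve-∀ ℚ-ring

    U′ L′ : ℚ
    U′ = M + D + η
    L′ = M - D - η

    -- When c ≥ M + D, the loss rate is at least c(2(M - D - η) - 3), which is nondecreasing in c by
    -- `3≤`. At c = M + D it is at least 2M² - κ by `≤κ`, the speed at which the upper edge
    -- descends.
    upper : ∀ {u v} → u ≢ v → let X = c u v - (M + D) in
      𝔼 (λ x y z → ψ⁸ (codeg (remove (corner? x y z) α) u v - (M′ + D′)))
        ≤ #tri * ψ⁸ X + Q 473088 * (q * q) * remainder (ψ⁸ X)
    upper {u} {v} u≢v = subst (_≤ #tri * ψ⁸ X + Q 473088 * (q * q) * remainder (ψ⁸ X))
      (𝔼-cong λ x y z → cong ψ⁸ (e₁ (c u v) (codeg (remove (corner? x y z) α) u v) M D κ h))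
      (average u v X (shift k (- 1ℚ) u v)
        (λ x y z → ≤-by (lit 2 ⊗ (0≤ℓ u v x y z ⊕ 0≤κ ⊗ 0≤h)) (e₂ (ℓ u v x y z) M κ h))
        (λ x y z → ≤-by (lit 4 ⊗ (0≤M ⊗ 0≤M ⊗ 0≤h)) (e₃ (ℓ u v x y z) M κ h))
        λ 0≤X → subst (_≤ 0ℚ) (sym (𝔼-shift (Q 2 * (M * M) - κ) (- 1ℚ) u v))
          (≤-by (gap (≤𝔼ℓ u≢v) ⊕ lit 6 ⊗ gap (≤drift {u} {v} {L′} ≤c) ⊕ lit 6 ⊗ (0≤X ⊗ gap 3≤) ⊕ lit 6 ⊗ gap ≤κ)
            (e₄ (𝔼 (ℓ u v)) (drift u v) (c u v) M D κ η)))
      where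
      X = c u v - (M + D)
      k = (Q 2 * (M * M) - κ) * h
      e₁ : ∀ c c′ M D κ h → c - (M + D) + ((Q 2 * (M * M) - κ) * h + - 1ℚ * (c - c′)) ≡
        c′ - (M - Q 2 * (M * M) * h + (D + κ * h))
      e₁ = solve-∀ ℚ-ring
      e₂ : ∀ l M κ h → l + h * (Q 2 * (M * M) + κ) - ((Q 2 * (M * M) - κ) * h + - 1ℚ * l) ≡ Q 2 * (l + κ * h)
      e₂ = solve-∀ ℚ-ring
      e₃ : ∀ l M κ h → (Q 2 * (M * M) - κ) * h + - 1ℚ * l - (- (l + h * (Q 2 * (M * M) + κ))) ≡ Q 4 *
          (M * M * h)
      e₃ = solve-∀ ℚ-ring
      e₄ : ∀ e d c M D κ η → 0ℚ - (Q 6 * (Q 2 * (M * M) - κ) + - 1ℚ * e) ≡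
        (e + Q 18 * c - Q 6 * d) + Q 6 * (d - c * (Q 2 * (M - D - η)))
          + Q 6 * ((c - (M + D)) * (Q 2 * (M - D - η) - Q 3))
          + Q 6 * (κ - (Q 2 * (D * D) + (Q 2 * η + Q 3) * (M + D)))
      e₄ = solve-∀ ℚ-ring

    -- When c ≤ M - D, the loss rate is at most 2(M - D)(M + D + η) ≤ 2M² + κ, the speed of the
    -- lower edge. Double counting errs in the favourable direction here, so `𝔼ℓ≤` is used without a
    -- correction.
    lower : ∀ {u v} → u ≢ v → let Y = M - D - c u v in
      𝔼 (λ x y z → ψ⁸ (M′ - D′ - codeg (remove (corner? x y z) α) u v))
        ≤ #tri * ψ⁸ Y + Q 473088 * (q * q) * remainder (ψ⁸ Y)
    lower {u} {v} u≢v = subst (_≤ #tri * ψ⁸ Y + Q 473088 * (q * q) * remainder (ψ⁸ Y))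
      (𝔼-cong λ x y z → cong ψ⁸ (e₁ (c u v) (codeg (remove (corner? x y z) α) u v) M D κ h))
      (average u v Y (shift k 1ℚ u v)
        (λ x y z → ≤-by (lit 2 ⊗ (0≤h ⊗ (lit 2 ⊗ (0≤M ⊗ 0≤M) ⊕ 0≤κ))) (e₂ (ℓ u v x y z) M κ h))
        (λ x y z → ≤-by (lit 2 ⊗ 0≤ℓ u v x y z) (e₃ (ℓ u v x y z) M κ h))
        λ 0≤Y → subst (_≤ 0ℚ) (sym (𝔼-shift (- (Q 2 * (M * M) + κ)) 1ℚ u v))
          (≤-by (gap (𝔼ℓ≤ u v) ⊕ lit 6 ⊗ gap (drift≤ {u} {v} {U′} c≤) ⊕ lit 12 ⊗ (0≤Y ⊗ (0≤M ⊕ 0≤D ⊕ 0≤η))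
              ⊕ lit 6 ⊗ gap ≤κ
              ⊕ (lit 24 ⊗ (0≤D ⊗ 0≤D ⊕ 0≤η ⊗ 0≤D) ⊕ lit 18 ⊗ (0≤M ⊕ 0≤D)))
            (e₄ (𝔼 (ℓ u v)) (drift u v) (c u v) M D κ η)))
      where
      Y = M - D - c u v
      k = (- (Q 2 * (M * M) + κ)) * h
      e₁ : ∀ c c′ M D κ h → M - D - c + ((- (Q 2 * (M * M) + κ)) * h + 1ℚ * (c - c′)) ≡
        M - Q 2 * (M * M) * h - (D + κ * h) - c′
      e₁ = solve-∀ ℚ-ring
      e₂ : ∀ l M κ h → l + h * (Q 2 * (M * M) + κ) - ((- (Q 2 * (M * M) + κ)) * h + 1ℚ * l) ≡ Q 2 *
          (h * (Q 2 * (M * M) + κ))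
      e₂ = solve-∀ ℚ-ring
      e₃ : ∀ l M κ h → (- (Q 2 * (M * M) + κ)) * h + 1ℚ * l - (- (l + h * (Q 2 * (M * M) + κ))) ≡ Q 2 * l
      e₃ = solve-∀ ℚ-ring
      e₄ : ∀ e d c M D κ η → 0ℚ - (Q 6 * (- (Q 2 * (M * M) + κ)) + 1ℚ * e) ≡
        (Q 6 * d - e) + Q 6 * (c * (Q 2 * (M + D + η)) - d)
          + Q 12 * ((M - D - c) * (M + D + η))
          + Q 6 * (κ - (Q 2 * (D * D) + (Q 2 * η + Q 3) * (M + D)))
          + (Q 24 * (D * D + η * D) + Q 18 * (M + D))
      e₄ = solve-∀ ℚ-ring

    B : ℚ
    B = Q 473088 * (q * q)

    𝔼dev≤ : ∀ {u v} → u ≢ v → 𝔼 (λ x y z → dev (remove (corner? x y z) α) M′ D′ u v)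
      ≤ (#tri + B * ψ) * dev α M D u v + B * (Q 2 * (Θ * Θ * Θ))
    𝔼dev≤ {u} {v} u≢v = subst₂ _≤_ (sym (𝔼-+ _ _)) (e #tri B ψ Θ _ _) (ℚ.+-mono-≤ (upper u≢v) (lower u≢v))
      where
      e : ∀ T B ψ Θ F G → T * F + B * (Θ * Θ * Θ + ψ * F) + (T * G + B * (Θ * Θ * Θ + ψ * G)) ≡
          (T + B * ψ) * (F + G) + B * (Q 2 * (Θ * Θ * Θ))
      e = solve-∀ ℚ-ring

    𝔼Φ≤ : 𝔼 (λ x y z → Φ (remove (corner? x y z) α) M′ D′)
      ≤ (#tri + B * ψ) * Φ α M D + B * (Q 2 * (Θ * Θ * Θ)) * (q * q)
    𝔼Φ≤ = begin
      𝔼 (λ x y z → Φ (remove (corner? x y z) α) M′ D′)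
        ≡⟨ trans (𝔼-∑ λ u x y z → ∑ λ v → distinct u v * dev (remove (corner? x y z) α) M′ D′ u v) (∑-cong λ u →
             trans (𝔼-∑ λ v x y z → distinct u v * dev (remove (corner? x y z) α) M′ D′ u v) (∑-cong λ v →
               𝔼-* (distinct u v) _)) ⟩
      (∑ λ u → ∑ λ v → distinct u v * 𝔼 (λ x y z → dev (remove (corner? x y z) α) M′ D′ u v))
        ≤⟨ (∑-mono-≤ λ u → ∑-mono-≤ λ v → distinct-mono u v 𝔼dev≤) ⟩
      (∑ λ u → ∑ λ v → distinct u v * (P * dev α M D u v + R))
        ≡⟨ (∑-cong λ u → trans (∑-cong λ v → e (distinct u v) P (dev α M D u v) R)
             (trans (∑-+ _ _) (cong₂ _+_ (sym (*-∑ P _)) (sym (*-∑ R _))))) ⟩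
      (∑ λ u → P * (∑ λ v → distinct u v * dev α M D u v) + R * (∑ λ v → distinct u v))
        ≡⟨ trans (∑-+ _ _) (cong₂ _+_ (sym (*-∑ P _)) (sym (*-∑ R _))) ⟩
      P * Φ α M D + R * (∑ λ u → ∑ λ v → distinct u v)
        ≤⟨ ℚ.+-monoʳ-≤ (P * Φ α M D) (*-monoˡ-≤ R 0≤R (∑∑distinct≤ n)) ⟩
      P * Φ α M D + R * (q * q) ∎
      where
      open ℚ.≤-Reasoning
      P = #tri + B * ψ
      R = B * (Q 2 * (Θ * Θ * Θ))
      0≤Θ = ℚ.≤-trans (lit 16) 16≤Θ
      0≤R : 0ℚ ≤ R
      0≤R = (lit 473088 ⊗ (0≤q ⊗ 0≤q)) ⊗ (lit 2 ⊗ (0≤Θ ⊗ 0≤Θ ⊗ 0≤Θ))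
      e : ∀ d P v R → d * (P * v + R) ≡ P * (d * v) + R * d
      e = solve-∀ ℚ-ring

  growth : ℚ
  growth = Q 262144 * (Q n * Q n * (Q n * Q n)) * (Θ * Θ * Θ)

  -- Since ψΦ ≤ n²Θ³, the second-order terms add up to at most 3 · 473088 n⁴Θ³, whereas h · #tri = 6
  -- makes the allowance 6 · 262144 n⁴Θ³. The excess, 153600 n⁴Θ³, makes the mean strictly positive,
  -- hence some triangle qualifies.
  good-triangle : 0ℚ < Q n → Φ α M D ≤ Q n * Q n * (Θ * Θ * (Θ * Θ)) →
    ∃[ x ] ∃[ y ] ∃[ z ] tri x y z ≡ true × Φ (remove (corner? x y z) α) M′ D′ < Φ α M D + growth * h
  good-triangle 0<q Φ≤ =
    let x , y , z , τ , 0<gap = 𝔼-pos⇒∃ _ (subst (0ℚ <_) (sym split) total)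
    in x , y , z , τ , <-by 0<gap (e₁ (Φ α M D + growth * h) (Φ (remove (corner? x y z) α) M′ D′))
    where
    e₁ : ∀ a b → a - b ≡ a + - 1ℚ * b
    e₁ = solve-∀ ℚ-ring
    E : ℚ
    E = 𝔼 (λ x y z → Φ (remove (corner? x y z) α) M′ D′)
    split : 𝔼 (λ x y z → Φ α M D + growth * h + - 1ℚ * Φ (remove (corner? x y z) α) M′ D′)
      ≡ (Φ α M D + growth * h) * #tri + - 1ℚ * E
    split = trans (𝔼-+ _ _) (cong₂ _+_ (𝔼-const (Φ α M D + growth * h)) (𝔼-* (- 1ℚ) _))
    0<Θ : 0ℚ < Θ
    0<Θ = ℚ.<-≤-trans (lit< 15) 16≤Θ
    e₂ : ∀ q φ h T E ψ Θ →
      (φ + Q 262144 * (q * q * (q * q)) * (Θ * Θ * Θ) * h) * T + - 1ℚ * E ≡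
        ((T + Q 473088 * (q * q) * ψ) * φ + Q 473088 * (q * q) * (Q 2 * (Θ * Θ * Θ)) * (q * q) - E)
        + Q 473088 * (q * q) * ψ * (q * q * (Θ * Θ * (Θ * Θ)) - φ)
        + Q 153600 * (q * q * (q * q) * (Θ * Θ * Θ))
        + (Q 262144 * (q * q * (q * q)) * (Θ * Θ * Θ) * (h * T - Q 6) - Q 473088 *
            (q * q * (q * q) * (Θ * Θ * Θ)) * (Θ * ψ - 1ℚ))
    e₂ = solve-∀ ℚ-ring
    e₃ : ∀ a b → a * (Q 6 - Q 6) - b * (1ℚ - 1ℚ) ≡ 0ℚ
    e₃ = solve-∀ ℚ-ring
    e₄ : ∀ x → x + 0ℚ ≡ x
    e₄ = solve-∀ ℚ-ring
    total : 0ℚ < (Φ α M D + growth * h) * #tri + - 1ℚ * E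
    total = subst (0ℚ <_) (sym (trans (e₂ q (Φ α M D) h #tri E ψ Θ)
        (trans (cong₂ (λ x y → main + (growth * (x - Q 6) - Q 473088 * (q * q * (q * q) * (Θ * Θ * Θ)) *
            (y - 1ℚ))) h-def Θψ≡1)
          (trans (cong (main +_) (e₃ growth (Q 473088 * (q * q * (q * q) * (Θ * Θ * Θ))))) (e₄ main)))))
      (gap 𝔼Φ≤ ⊕ (lit 473088 ⊗ (0≤q ⊗ 0≤q)) ⊗ 0≤ψ ⊗ gap Φ≤
        ⊕< lit< 153599 ⊗< (0<q ⊗< 0<q ⊗< (0<q ⊗< 0<q) ⊗< (0<Θ ⊗< 0<Θ ⊗< 0<Θ)))
      where
      main = ((#tri + B * ψ) * Φ α M D + B * (Q 2 * (Θ * Θ * Θ)) * (q * q) - E)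
        + B * ψ * (q * q * (Θ * Θ * (Θ * Θ)) - Φ α M D)
        + Q 153600 * (q * q * (q * q) * (Θ * Θ * Θ))

-- From the potential to single pairs

module _ {n : ℕ} (α : Fin n → Fin n → Bool) {M D : ℚ} where

  private
    dev≤Φ : ∀ {u v} → u ≢ v → dev α M D u v ≤ Φ α M D
    dev≤Φ {u} {v} u≢v = ℚ.≤-trans (ℚ.≤-reflexive (sym one))
      (ℚ.≤-trans (≤∑ (0≤term u) v) (≤∑ {f = λ u → ∑ λ v → distinct u v * dev α M D u v}
          (λ u → 0≤∑ (0≤term u)) u))
      where
      0≤term : ∀ u v → 0ℚ ≤ distinct u v * dev α M D u v
      0≤term u v = 0≤𝟙 (not (does (u Fin.≟ v))) ⊗ 0≤dev α M D u v
      one : distinct u v * dev α M D u v ≡ dev α M D u v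
      one with u Fin.≟ v
      ... | yes u≡v = contradiction u≡v u≢v
      ... | no  _   = ℚ.*-identityˡ (dev α M D u v)

    ψ⁸<⇒≤ : ∀ {x η} → 0ℚ ≤ η → ψ⁸ x < η ⁸ → x ≤ η
    ψ⁸<⇒≤ {x} {η} 0≤η lt with ℚ.≤-total x η
    ... | inj₁ x≤η = x≤η
    ... | inj₂ η≤x = contradiction (ℚ.<-≤-trans lt (⁸-mono 0≤η (ℚ.≤-trans η≤x (ℚ.p≤p⊔q x 0ℚ))))
        (ℚ.<-irrefl refl)

  -- All terms of `Φ` are nonnegative, and one pair beyond the tolerance would alone contribute at
  -- least η⁸.
  Φ<⇒≤ : ∀ {η} → 0ℚ ≤ η → Φ α M D < η ⁸ → ∀ {u v} → u ≢ v → codeg α u v ≤ M + D + η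
  Φ<⇒≤ {η} 0≤η Φ< {u} {v} u≢v = ≤-by (gap (ψ⁸<⇒≤ 0≤η (ℚ.≤-<-trans
      (≤-by (0≤⁸ ((M - D - codeg α u v) ⁺)) (e₁ (ψ⁸ (codeg α u v - (M + D))) (ψ⁸ (M - D - codeg α u v))))
          (ℚ.≤-<-trans (dev≤Φ u≢v) Φ<))))
    (e₂ M D η (codeg α u v))
    where
    e₁ : ∀ x y → x + y - x ≡ y
    e₁ = solve-∀ ℚ-ring
    e₂ : ∀ M D η c → M + D + η - c ≡ η - (c - (M + D))
    e₂ = solve-∀ ℚ-ring

  Φ<⇒≥ : ∀ {η} → 0ℚ ≤ η → Φ α M D < η ⁸ → ∀ {u v} → u ≢ v → M - D - η ≤ codeg α u v
  Φ<⇒≥ {η} 0≤η Φ< {u} {v} u≢v = ≤-by (gap (ψ⁸<⇒≤ 0≤η (ℚ.≤-<-trans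
      (≤-by (0≤⁸ ((codeg α u v - (M + D)) ⁺)) (e₁ (ψ⁸ (codeg α u v - (M + D)))
          (ψ⁸ (M - D - codeg α u v)))) (ℚ.≤-<-trans (dev≤Φ u≢v) Φ<))))
    (e₂ M D η (codeg α u v))
    where
    e₁ : ∀ x y → x + y - y ≡ x
    e₁ = solve-∀ ℚ-ring
    e₂ : ∀ M D η c → c - (M - D - η) ≡ η - (M - D - c)
    e₂ = solve-∀ ℚ-ring

  Φ≤0 : (∀ {u v} → u ≢ v → M - D ≤ codeg α u v × codeg α u v ≤ M + D) → Φ α M D ≤ 0ℚ
  Φ≤0 within = ℚ.≤-trans (∑-mono-≤ λ u → ℚ.≤-trans
      (∑-mono-≤ λ v → distinct-mono u v {q = 0ℚ} (λ u≢v → ℚ.≤-reflexive (zero-dev u≢v)))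
      (ℚ.≤-reflexive (∑-zero λ v → ℚ.*-zeroʳ (distinct u v))))
          (ℚ.≤-reflexive (∑-zero {f = λ (u : Fin n) → 0ℚ} λ _ → refl))
    where
    e₁ : ∀ c m → 0ℚ - (c - m) ≡ m - c
    e₁ = solve-∀ ℚ-ring
    ψ⁸≡0 : ∀ x → x ≤ 0ℚ → ψ⁸ x ≡ 0ℚ
    ψ⁸≡0 x x≤0 = cong _⁸ (ℚ.p≤q⇒p⊔q≡q {x} {0ℚ} x≤0)
    zero-dev : ∀ {u v} → u ≢ v → dev α M D u v ≡ 0ℚ
    zero-dev {u} {v} u≢v = cong₂ _+_
      (ψ⁸≡0 (codeg α u v - (M + D)) (≤-by (gap (proj₂ (within u≢v))) (e₁ (codeg α u v) (M + D))))
      (ψ⁸≡0 (M - D - codeg α u v) (≤-by (gap (proj₁ (within u≢v))) (e₁ (M - D) (codeg α u v))))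

-- Counting triangles and paths of length two

deg : ∀ {n} → (Fin n → Fin n → Bool) → Fin n → ℚ
deg α v = ∑ λ w → 𝟙 (α v w)

module Count {n : ℕ} (α : Fin n → Fin n → Bool)
  (α-sym : ∀ u v → α u v ≡ α v u) (α-irrefl : ∀ u → α u u ≡ false) where

  open Triangles α α-sym α-irrefl
  open Loss α α-sym α-irrefl using (adj⇒≢; 0≤c)

  #tri≤n³ : #tri ≤ Q n * (Q n * Q n)
  #tri≤n³ = subst (#tri ≤_) (trans (∑-cong λ x → trans
      (∑-cong λ y → trans (∑-const n 1ℚ) (ℚ.*-identityʳ (Q n))) (∑-const n (Q n))) (∑-const n (Q n * Q n)))
    (∑³-mono-≤ {G = λ _ _ _ → 1ℚ} λ x y z → subst (_≤ 1ℚ) (sym (ℚ.*-identityʳ (wt x y z))) (𝟙≤1 (tri x y z)))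

  c≤deg : ∀ u v → c u v ≤ deg α u
  c≤deg u v = ∑-mono-≤ λ w → subst (a u w * a v w ≤_) (ℚ.*-identityʳ (a u w))
      (*-monoˡ-≤ (a u w) (0≤𝟙 (α u w)) (𝟙≤1 (α v w)))

  c-diag : ∀ v → c v v ≡ deg α v
  c-diag v = ∑-cong λ w → 𝟙-idem (α v w)

  adj-mono : ∀ {p q} u v → (u ≢ v → p ≤ q) → a u v * p ≤ a u v * q
  adj-mono {p} {q} u v p≤q with α u v in αuv
  ... | false = ℚ.≤-reflexive (trans (ℚ.*-zeroˡ p) (sym (ℚ.*-zeroˡ q)))
  ... | true  = *-monoˡ-≤ 1ℚ 0≤1 (p≤q (adj⇒≢ αuv))

  -- Every codegree bounds a degree from below, so all degrees are at least l and there are at least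
  -- nl ordered adjacent pairs, each in at least l triangles.
  nl²≤#tri : ∀ {l} → 0ℚ ≤ l → (∀ {u v} → u ≢ v → l ≤ c u v) → (∀ (u : Fin n) → ∃[ v ] u ≢ v) → Q n *
      (l * l) ≤ #tri
  nl²≤#tri {l} 0≤l l≤c other = begin
    Q n * (l * l)
      ≡⟨ sym (∑-const n (l * l)) ⟩
    ∑ {n} (λ _ → l * l)
      ≤⟨ ∑-mono-≤ (λ x → *-monoˡ-≤ l 0≤l (ℚ.≤-trans (l≤c (proj₂ (other x))) (c≤deg x (proj₁ (other x))))) ⟩
    ∑ (λ x → l * deg α x)
      ≡⟨ ∑-cong (λ x → *-∑ l (a x)) ⟩
    ∑ (λ x → ∑ λ y → l * a x y)
      ≤⟨ ∑-mono-≤ (λ x → ∑-mono-≤ λ y → subst (_≤ a x y * c x y) (ℚ.*-comm (a x y) l) (adj-mono x y l≤c)) ⟩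
    ∑ (λ x → ∑ λ y → a x y * c x y)
      ≡⟨ ∑-cong (λ x → ∑-cong λ y → trans (*-∑ (a x y) _) (∑-cong λ z →
           trans (cong (a x y *_) (ℚ.*-comm (a x z) (a y z)))
               (trans (sym (wt≡ x y z)) (sym (ℚ.*-identityʳ (wt x y z)))))) ⟩
    #tri ∎
    where open ℚ.≤-Reasoning

  -- Both sides of Σ_{w,w'∈N(v)} codeg(w,w') = Σ_x codeg(v,x)² are estimated.
  deg²-bound : ∀ {l U} → 0ℚ ≤ l → 0ℚ ≤ U → (∀ {u v} → u ≢ v → l ≤ c u v) → (∀ {u v} → u ≢ v → c u v ≤ U) →
    ∀ v → deg α v * deg α v * l - deg α v * l ≤ Q n * (U * U) + deg α v * deg α v
  deg²-bound {l} {U} 0≤l 0≤U l≤c c≤U v = begin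
    d * d * l - d * l
      ≡⟨ sym lhs ⟩
    ∑ (λ w → ∑ λ w′ → a v w * (a v w′ * (l + - l * δ w w′)))
      ≤⟨ ∑-mono-≤ (λ w → ∑-mono-≤ λ w′ → *-monoˡ-≤ (a v w) (0≤𝟙 (α v w))
          (*-monoˡ-≤ (a v w′) (0≤𝟙 (α v w′)) (off-diagonal w w′))) ⟩
    ∑ (λ w → ∑ λ w′ → a v w * (a v w′ * c w w′))
      ≡⟨ double ⟩
    ∑ (λ x → c v x * c v x)
      ≤⟨ ∑-mono-≤ square ⟩
    ∑ (λ x → U * U + δ x v * (d * d))
      ≡⟨ trans (∑-+ _ _) (cong₂ _+_ (∑-const n (U * U)) (∑-δ (λ _ → d * d) v)) ⟩
    Q n * (U * U) + d * d ∎
    where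
    open ℚ.≤-Reasoning
    d = deg α v
    off-diagonal : ∀ w w′ → l + - l * δ w w′ ≤ c w w′
    off-diagonal w w′ with w Fin.≟ w′
    ... | yes _   = subst (_≤ c w w′) (e l) (0≤c w w′)
      where
      e : ∀ l → 0ℚ ≡ l + - l * 1ℚ
      e = solve-∀ ℚ-ring
    ... | no w≢w′ = subst (_≤ c w w′) (e l) (l≤c w≢w′)
      where
      e : ∀ l → l ≡ l + - l * 0ℚ
      e = solve-∀ ℚ-ring
    -- The term x = v is the square of the degree rather than of a codegree; this is the summand d²
    -- of the bound.
    square : ∀ x → c v x * c v x ≤ U * U + δ x v * (d * d)
    square x with x Fin.≟ v
    ... | yes refl = subst (_≤ U * U + 1ℚ * (d * d)) (cong₂ _*_ (sym (c-diag v)) (sym (c-diag v)))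
        (≤-by (0≤U ⊗ 0≤U) (e U (d * d)))
      where
      e : ∀ U z → U * U + 1ℚ * z - z ≡ U * U
      e = solve-∀ ℚ-ring
    ... | no x≢v = subst (c v x * c v x ≤_) (e (U * U) (d * d)) (²-mono (0≤c v x) (c≤U (λ v≡x → x≢v (sym v≡x))))
      where
      e : ∀ z y → z ≡ z + 0ℚ * y
      e = solve-∀ ℚ-ring
    lhs : ∑ (λ w → ∑ λ w′ → a v w * (a v w′ * (l + - l * δ w w′))) ≡ d * d * l - d * l
    lhs = trans (∑-cong row) (trans (∑-cong (λ w → e₂ (a v w) (𝟙-idem (α v w))))
        (trans (sym (*-∑ (d * l - l) (a v))) (e₃ d l)))
      where
      e₁ : ∀ p q l z → p * (q * (l + - l * z)) ≡ (p * l) * q + (- (p * l)) * (z * q)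
      e₁ = solve-∀ ℚ-ring
      row : ∀ w → ∑ (λ w′ → a v w * (a v w′ * (l + - l * δ w w′))) ≡ a v w * l * d + (- (a v w * l)) * a v w
      row w = trans (∑-cong λ w′ → trans (e₁ (a v w) (a v w′) l (δ w w′))
          (cong (λ z → (a v w * l) * a v w′ + (- (a v w * l)) * (z * a v w′)) (δ-sym w w′)))
        (trans (∑-+ _ _) (cong₂ _+_ (sym (*-∑ (a v w * l) (a v)))
            (trans (sym (*-∑ (- (a v w * l)) _)) (cong ((- (a v w * l)) *_) (∑-δ (a v) w)))))
      e₄ : ∀ p l d → p * l * d + (- (p * l)) * p ≡ (d * l) * p - l * (p * p)
      e₄ = solve-∀ ℚ-ring
      e₅ : ∀ p l d → (d * l) * p - l * p ≡ (d * l - l) * p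
      e₅ = solve-∀ ℚ-ring
      e₂ : ∀ p → p * p ≡ p → p * l * d + (- (p * l)) * p ≡ (d * l - l) * p
      e₂ p pp≡p = trans (e₄ p l d) (trans (cong (λ z → (d * l) * p - l * z) pp≡p) (e₅ p l d))
      e₃ : ∀ d l → (d * l - l) * d ≡ d * d * l - d * l
      e₃ = solve-∀ ℚ-ring
    double : ∑ (λ w → ∑ λ w′ → a v w * (a v w′ * c w w′)) ≡ ∑ (λ x → c v x * c v x)
    double = trans (∑-cong λ w → trans (∑-cong λ w′ → trans (e₁ (a v w) (a v w′) (c w w′))
        (*-∑ (a v w * a v w′) _)) (∑-swap λ w′ x → a v w * a v w′ * (a w x * a w′ x)))
      (trans (∑-swap λ w x → ∑ λ w′ → a v w * a v w′ * (a w x * a w′ x)) (∑-cong λ x →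
        trans (∑-cong λ w → trans (∑-cong λ w′ → trans (e₂ (a v w) (a v w′) (a w x) (a w′ x))
            (cong₂ (λ y z → (a v w * y) * (a v w′ * z)) (a-sym w x) (a-sym w′ x)))
            (sym (*-∑ (a v w * a x w) _)))
          (trans (∑-cong λ w → ℚ.*-comm (a v w * a x w) (c v x)) (sym (*-∑ (c v x) _)))))
      where
      e₁ : ∀ p q z → p * (q * z) ≡ p * q * z
      e₁ = solve-∀ ℚ-ring
      e₂ : ∀ p q r s → p * q * (r * s) ≡ (p * r) * (q * s)
      e₂ = solve-∀ ℚ-ring

-- Choice of the parameters

inverse : ∀ {x} → 0ℚ < x → ∃[ y ] 0ℚ < y × x * y ≡ 1ℚ
inverse {x} 0<x = (ℚ.1/ x) {{x≢0}} , ℚ.positive⁻¹ _ {{ℚ.1/pos⇒pos x {{positive 0<x}}}} , ℚ.*-inverseʳ x {{x≢0}}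
  where x≢0 = ℚ.pos⇒nonZero x {{positive 0<x}}

archimedean : ∀ x → ∃[ k ] x ≤ Q k
archimedean x@(ℚ.mkℚ i d _) = ℤ.∣ i ∣ ,
  ℚ.*≤* (ℤ.≤-trans (ℤ.≤-reflexive (ℤ.*-identityʳ i)) (ℤ.≤-trans (i≤∣i∣ i)
    (subst (ℤ._≤ pos ℤ.∣ i ∣ ℤ.* pos (suc d)) (ℤ.*-identityʳ (pos ℤ.∣ i ∣))
        (ℤ.*-monoˡ-≤-nonNeg (pos ℤ.∣ i ∣) (ℤ.+≤+ (ℕ.s≤s ℕ.z≤n))))))
  where
  i≤∣i∣ : ∀ i → i ℤ.≤ pos ℤ.∣ i ∣
  i≤∣i∣ (pos k)    = ℤ.≤-refl
  i≤∣i∣ ℤ.-[1+ k ] = ℤ.-≤+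

pow-≤1 : ∀ {x} → 0ℚ ≤ x → x ≤ 1ℚ → x ² ≤ 1ℚ
pow-≤1 {x} 0≤x x≤1 = ≤-by (gap x≤1 ⊗ (0≤1 ⊕ 0≤x)) (eq x)
  where
  eq : ∀ x → 1ℚ - x * x ≡ (1ℚ - x) * (1ℚ + x)
  eq = solve-∀ ℚ-ring

-- At time s the codegrees lie within D s + η of M, where M ≥ m / 128.  The term κ s of D
-- pays for the drift estimates; √Θ is the size of the fluctuations, and the tolerance η
-- exceeds it by a power of n, which is what the eighth power needs to beat the n² pairs.
module Parameters {n : ℕ} {e K : ℚ} (0<e : 0ℚ < e) (eK≡1 : e * K ≡ 1ℚ)
  (small : Q 8192 * e ≤ 1ℚ) (large : 1ℚ ≤ Q n * (e ⁸ ² ²)) where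

  -- In `κ` the 10 covers 2D² ≤ 2e⁶q², then 2η(M + D) ≤ 6e⁶q² as M + D ≤ 3q, and the lower-order 3(M
  -- + D) ≤ 9q. In `Θ`, 16777216 = 64 · 262144: the bound `growth * s` ≤ q²Θ⁴ amounts to 262144q²s ≤
  -- Θ, and the time satisfies s ≤ 64/m = 64K²/q.
  q m e⁶ κ η Θ : ℚ
  q  = Q n
  m  = e ² * q
  e⁶ = e ² * e ² * e ²
  κ  = Q 10 * e⁶ * (q * q)
  η  = e⁶ * q
  Θ  = Q 16777216 * (q * (K * K))

  -- The start value is the relative error 512e⁴ of typicality times 2q, an upper bound for the
  -- first M.
  D : ℚ → ℚ
  D s = Q 1024 * (e ² * e ²) * q + κ * s

  0≤e : 0ℚ ≤ e
  0≤e = ℚ.<⇒≤ 0<e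

  0≤q : 0ℚ ≤ q
  0≤q = lit n

  e≤1 : e ≤ 1ℚ
  e≤1 = ≤-by (gap small ⊕ lit 8191 ⊗ 0≤e) (eq e)
    where
    eq : ∀ e → 1ℚ - e ≡ (1ℚ - Q 8192 * e) + Q 8191 * e
    eq = solve-∀ ℚ-ring

  0<K : 0ℚ < K
  0<K = *-cancelˡ-< e 0<e (subst₂ _<_ (sym (ℚ.*-zeroʳ e)) (sym eK≡1) (lit< 0))

  0≤K : 0ℚ ≤ K
  0≤K = ℚ.<⇒≤ 0<K

  1≤K : 1ℚ ≤ K
  1≤K = subst (_≤ K) eK≡1 (subst (e * K ≤_) (ℚ.*-identityˡ K) (*-mono-≤ 0≤e 0≤K e≤1 ℚ.≤-refl))

  -- 67108864 = 8192². Since all powers of e are at most 1, `large` yields qe⁸ ≥ 1, and dividing by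
  -- e² ≤ 1/8192² gives the bound.
  big : Q 67108864 ≤ q * e⁶
  big = ≤-by (lit 67108864 ⊗ gap 1≤qe⁸ ⊕ (0≤q ⊗ (0≤sq e ⊗ 0≤sq e ⊗ 0≤sq e)) ⊗
      (gap small ⊗ (0≤1 ⊕ lit 8192 ⊗ 0≤e))) (eq q e)
    where
    e⁸≤1 : e ⁸ ≤ 1ℚ
    e⁸≤1 = pow-≤1 (0≤sq (e ²)) (pow-≤1 (0≤sq e) (pow-≤1 0≤e e≤1))
    e²⁴≤1 : e ⁸ ² * e ⁸ ≤ 1ℚ
    e²⁴≤1 = *-mono-≤ {q = 1ℚ} {s = 1ℚ} (0≤sq (e ⁸)) (0≤⁸ e) (pow-≤1 (0≤⁸ e) e⁸≤1) e⁸≤1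
    1≤qe⁸ : 1ℚ ≤ q * e ⁸
    1≤qe⁸ = ≤-by (gap large ⊕ (0≤q ⊗ 0≤⁸ e) ⊗ gap e²⁴≤1) (eq′ q (e ⁸))
      where
      eq′ : ∀ q x → q * x - 1ℚ ≡ (q * (x * x * (x * x)) - 1ℚ) + q * x * (1ℚ - x * x * x)
      eq′ = solve-∀ ℚ-ring
    eq : ∀ q e → q * (e * e * (e * e) * (e * e)) - Q 67108864 ≡
      Q 67108864 * (q * (e * e * (e * e) * (e * e * (e * e))) - 1ℚ)
        + q * (e * e * (e * e) * (e * e)) * ((1ℚ - Q 8192 * e) * (1ℚ + Q 8192 * e))
    eq = solve-∀ ℚ-ring

  private
    e²≤1 : e ² ≤ 1ℚ
    e²≤1 = pow-≤1 0≤e e≤1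

  big₄ : Q 67108864 ≤ q * (e ² * e ²)
  big₄ = ≤-by (gap big ⊕ 0≤q ⊗ (0≤sq e ⊗ 0≤sq e) ⊗ gap e²≤1) (eq q (e ²))
    where
    eq : ∀ q x → q * (x * x) - Q 67108864 ≡ q * (x * x * x) - Q 67108864 + q * (x * x) * (1ℚ - x)
    eq = solve-∀ ℚ-ring

  big₂ : Q 67108864 ≤ m
  big₂ = ≤-by (gap big₄ ⊕ 0≤q ⊗ 0≤sq e ⊗ gap e²≤1) (eq q (e ²))
    where
    eq : ∀ q x → x * q - Q 67108864 ≡ q * (x * x) - Q 67108864 + q * x * (1ℚ - x)
    eq = solve-∀ ℚ-ring

  big₁ : Q 67108864 ≤ e * q
  big₁ = ≤-by (gap big₂ ⊕ 0≤q ⊗ 0≤e ⊗ gap e≤1) (eq q e)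
    where
    eq : ∀ q x → x * q - Q 67108864 ≡ x * x * q - Q 67108864 + q * x * (1ℚ - x)
    eq = solve-∀ ℚ-ring

  big₀ : Q 67108864 ≤ q
  big₀ = ≤-by (gap big₁ ⊕ 0≤q ⊗ gap e≤1) (eq q e)
    where
    eq : ∀ q x → q - Q 67108864 ≡ x * q - Q 67108864 + q * (1ℚ - x)
    eq = solve-∀ ℚ-ring

  0<q : 0ℚ < q
  0<q = ℚ.<-≤-trans (lit< 67108863) big₀

  0≤m : 0ℚ ≤ m
  0≤m = 0≤sq e ⊗ 0≤q

  0≤e⁶ : 0ℚ ≤ e⁶
  0≤e⁶ = 0≤sq e ⊗ 0≤sq e ⊗ 0≤sq e

  0≤κ : 0ℚ ≤ κ
  0≤κ = lit 10 ⊗ 0≤e⁶ ⊗ (0≤q ⊗ 0≤q)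

  0≤η : 0ℚ ≤ η
  0≤η = 0≤e⁶ ⊗ 0≤q

  16≤Θ : Q 16 ≤ Θ
  16≤Θ = ≤-by (lit 16777216 ⊗ (gap (ℚ.≤-trans {j = Q 67108864} (lit-mono) big₀) ⊗ (0≤K ⊗ 0≤K) ⊕ gap
      (*-mono-≤ 0≤1 0≤1 1≤K 1≤K)) ⊕ lit 16777200) (eq q K)
    where
    lit-mono : 1ℚ ≤ Q 67108864
    lit-mono = ≤-by (lit 67108863) refl
    eq : ∀ q K → Q 16777216 * (q * (K * K)) - Q 16 ≡ Q 16777216 * ((q - 1ℚ) * (K * K) + (K * K - 1ℚ * 1ℚ))
        + Q 16777200
    eq = solve-∀ ℚ-ring

  Θ-inverse : ∃[ ψ ] 0ℚ < ψ × Θ * ψ ≡ 1ℚ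
  Θ-inverse = inverse (ℚ.<-≤-trans (lit< 15) 16≤Θ)

  -- Multiplication by e¹⁶ clears K and leaves 2⁹⁶q⁶e⁸ < q⁶(qe³²)². The square is at least 1 by
  -- `large`, and 2⁹⁶e⁸ ≤ 1/256 because (8192e)⁸ ≤ 1.
  Θ⁴<η⁸ : q * q * (Θ * Θ * (Θ * Θ)) < η ⁸
  Θ⁴<η⁸ = *-cancelˡ-< (e ⁸ * e ⁸) (0<e⁸ ⊗< 0<e⁸) (subst₂ _<_
      (trans (eq₁ q e K) (trans (cong (λ x → e ⁸ * e ⁸ * (q * q * (Θ * Θ * (Θ * Θ))) - Q
          79228162514264337593543950336 * (q * q * q * q * q * q) * e ⁸ * (x ⁸ - 1ℚ)) eK≡1)
        (eq₃ (e ⁸ * e ⁸ * (q * q * (Θ * Θ * (Θ * Θ))))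
            (Q 79228162514264337593543950336 * (q * q * q * q * q * q) * e ⁸))))
      (sym (eq₂ q e)) core)
    where
    0<e⁸ : 0ℚ < e ⁸
    0<e⁸ = let 0<e⁴ = (0<e ⊗< 0<e) ⊗< (0<e ⊗< 0<e) in 0<e⁴ ⊗< 0<e⁴
    q⁶ = q * q * q * q * q * q
    eq₁ : ∀ q e K → Q 79228162514264337593543950336 * (q * q * q * q * q * q) *
        (e * e * (e * e) * (e * e * (e * e))) ≡
      (e * e * (e * e) * (e * e * (e * e))) * (e * e * (e * e) * (e * e * (e * e))) *
          (q * q * ((Q 16777216 * (q * (K * K))) * (Q 16777216 * (q * (K * K))) *
          ((Q 16777216 * (q * (K * K))) * (Q 16777216 * (q * (K * K))))))
        - Q 79228162514264337593543950336 * (q * q * q * q * q * q) *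
            (e * e * (e * e) * (e * e * (e * e))) *
            (((e * K) * (e * K) * ((e * K) * (e * K)) * ((e * K) * (e * K) * ((e * K) * (e * K)))) - 1ℚ)
    eq₁ = solve-∀ ℚ-ring
    eq₂ : ∀ q e → (e * e * (e * e) * (e * e * (e * e))) * (e * e * (e * e) * (e * e * (e * e))) *
        ((e * e * (e * e) * (e * e) * q) * (e * e * (e * e) * (e * e) * q) *
        ((e * e * (e * e) * (e * e) * q) * (e * e * (e * e) * (e * e) * q)) *
        ((e * e * (e * e) * (e * e) * q) * (e * e * (e * e) * (e * e) * q) *
        ((e * e * (e * e) * (e * e) * q) * (e * e * (e * e) * (e * e) * q)))) ≡
      q * q * q * q * q * q * (q * ((e * e * (e * e) * (e * e * (e * e))) *
          (e * e * (e * e) * (e * e * (e * e))) * ((e * e * (e * e) * (e * e * (e * e))) *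
          (e * e * (e * e) * (e * e * (e * e))))) *
          (q * ((e * e * (e * e) * (e * e * (e * e))) * (e * e * (e * e) * (e * e * (e * e))) *
          ((e * e * (e * e) * (e * e * (e * e))) * (e * e * (e * e) * (e * e * (e * e)))))))
    eq₂ = solve-∀ ℚ-ring
    eq₃ : ∀ x y → x - y * ((1ℚ * 1ℚ * (1ℚ * 1ℚ) * (1ℚ * 1ℚ * (1ℚ * 1ℚ))) - 1ℚ) ≡ x
    eq₃ = solve-∀ ℚ-ring
    core : Q 79228162514264337593543950336 * q⁶ * e ⁸ < q⁶ * (q * (e ⁸ ² ²) * (q * (e ⁸ ² ²)))
    core = <-by (0≤q⁶ ⊗ gap (*-mono-≤ 0≤1 0≤1 large large) ⊕< 0<q⁶ ⊗< 0<1-w) (eq₄ q⁶ (q * (e ⁸ ² ²)) (e ⁸))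
      where
      0≤q⁶ = 0≤q ⊗ 0≤q ⊗ 0≤q ⊗ 0≤q ⊗ 0≤q ⊗ 0≤q
      0<q⁶ = 0<q ⊗< 0<q ⊗< 0<q ⊗< 0<q ⊗< 0<q ⊗< 0<q
      w = Q 79228162514264337593543950336 * e ⁸
      256w≤1 : Q 256 * w ≤ 1ℚ
      256w≤1 = subst (_≤ 1ℚ) (eq e) (pow-≤1 (0≤sq ((Q 8192 * e) ²))
          (pow-≤1 (0≤sq (Q 8192 * e)) (pow-≤1 (lit 8192 ⊗ 0≤e) small)))
        where
        eq : ∀ e → ((Q 8192 * e) * (Q 8192 * e) * ((Q 8192 * e) * (Q 8192 * e)) *
            ((Q 8192 * e) * (Q 8192 * e) * ((Q 8192 * e) * (Q 8192 * e)))) ≡ Q 256 *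
            (Q 79228162514264337593543950336 * (e * e * (e * e) * (e * e * (e * e))))
        eq = solve-∀ ℚ-ring
      0<1-w : 0ℚ < 1ℚ - w
      0<1-w = subst (0ℚ <_) (eq w) (gap 256w≤1 ⊕< lit< 254 ⊗< (lit< 79228162514264337593543950335 ⊗< 0<e⁸))
        where
        eq : ∀ w → 1ℚ - Q 256 * w + Q 255 * w ≡ 1ℚ - w
        eq = solve-∀ ℚ-ring
      eq₄ : ∀ a Y x → a * (Y * Y) - Q 79228162514264337593543950336 * a * x ≡ a * (Y * Y - 1ℚ * 1ℚ) + a *
          (1ℚ - Q 79228162514264337593543950336 * x)
      eq₄ = solve-∀ ℚ-ring

-- Invariants along the trajectory

module Envelope {n : ℕ} {e K : ℚ} (0<e : 0ℚ < e) (eK≡1 : e * K ≡ 1ℚ)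
  (small : Q 8192 * e ≤ 1ℚ) (large : 1ℚ ≤ Q n * (e ⁸ ² ²)) where

  open Parameters {n} 0<e eK≡1 small large

  -- Discrete steps do not follow the solution of M′ = -2M² exactly. The inequality 2Ms ≤ 1 survives
  -- them and suffices: with M ≥ m/128 it limits the time to 64/m.
  record Controlled (s M : ℚ) : Set where
    field
      0≤s  : 0ℚ ≤ s
      2Ms≤1 : Q 2 * M * s ≤ 1ℚ
      m≤ : m ≤ Q 128 * M
      M≤ : M ≤ Q 2 * q

  growth : ℚ
  growth = Q 262144 * (q * q * (q * q)) * (Θ * Θ * Θ)

  private
    g : ℚ
    g = e ² * e * q

    0≤g : 0ℚ ≤ g
    0≤g = 0≤sq e ⊗ 0≤e ⊗ 0≤q

    8192g≤m : Q 8192 * g ≤ m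
    8192g≤m = ≤-by (0≤m ⊗ gap small) (eq e q)
      where
      eq : ∀ e q → e * e * q - Q 8192 * (e * e * e * q) ≡ e * e * q * (1ℚ - Q 8192 * e)
      eq = solve-∀ ℚ-ring

    e³≤1 : e ² * e ≤ 1ℚ
    e³≤1 = *-mono-≤ {q = 1ℚ} {s = 1ℚ} (0≤sq e) 0≤e (pow-≤1 0≤e e≤1) e≤1

    e⁵≤1 : e ² * e ² * e ≤ 1ℚ
    e⁵≤1 = *-mono-≤ {q = 1ℚ} {s = 1ℚ} (0≤sq e ⊗ 0≤sq e) 0≤e (pow-≤1 (0≤sq e) (pow-≤1 0≤e e≤1)) e≤1

    η≤g : η ≤ g
    η≤g = ≤-by (0≤g ⊗ gap e³≤1) (eq e q)
      where
      eq : ∀ e q → e * e * e * q - e * e * (e * e) * (e * e) * q ≡ e * e * e * q * (1ℚ - e * e * e)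
      eq = solve-∀ ℚ-ring

    g≤q : g ≤ q
    g≤q = ≤-by (0≤q ⊗ gap e³≤1) (eq e q)
      where
      eq : ∀ e q → q - e * e * e * q ≡ q * (1ℚ - e * e * e)
      eq = solve-∀ ℚ-ring

  big⇒ : ∀ {x} k → Q 67108864 ≤ x → Q k ≤ Q 67108864 → Q k ≤ x
  big⇒ k big k≤ = ℚ.≤-trans k≤ big

  κ≤q² : κ ≤ q * q
  κ≤q² = ≤-by ((0≤q ⊗ 0≤q) ⊗ (gap small ⊕ lit 8182 ⊗ 0≤e ⊕ lit 10 ⊗ (0≤e ⊗ gap e⁵≤1))) (eq e q)
    where
    eq : ∀ e q → q * q - Q 10 * (e * e * (e * e) * (e * e)) * (q * q) ≡
      q * q * (1ℚ - Q 8192 * e + Q 8182 * e + Q 10 * (e * (1ℚ - e * e * (e * e) * e)))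
    eq = solve-∀ ℚ-ring

  module _ {s M : ℚ} (controlled : Controlled s M) where
    open Controlled controlled

    128M-big : Q 67108864 ≤ Q 128 * M
    128M-big = ℚ.≤-trans big₂ m≤

    2≤M : Q 2 ≤ M
    2≤M = *-cancelˡ-≤ (Q 128) (lit< 127) (ℚ.≤-trans (≤-by (lit 67108608) refl) 128M-big)

    0≤M : 0ℚ ≤ M
    0≤M = ℚ.≤-trans (lit 2) 2≤M

    sm≤64 : s * m ≤ Q 64
    sm≤64 = ≤-by (lit 64 ⊗ gap 2Ms≤1 ⊕ 0≤s ⊗ gap m≤) (eq s m M)
      where
      eq : ∀ s m M → Q 64 - s * m ≡ Q 64 * (1ℚ - Q 2 * M * s) + s * (Q 128 * M - m)
      eq = solve-∀ ℚ-ring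

    0≤D : 0ℚ ≤ D s
    0≤D = lit 1024 ⊗ (0≤sq e ⊗ 0≤sq e) ⊗ 0≤q ⊕ 0≤κ ⊗ 0≤s

    -- With s ≤ 64/m the growth κs is at most 640e⁴q, so D is at most 1664e⁴q, and 8192e ≤ 1 turns
    -- this into e³q.
    D≤g : D s ≤ g
    D≤g = ≤-by (0≤m ⊗ 0≤e ⊗ gap small ⊕ (0≤sq e ⊗ 0≤sq e ⊗ 0≤q) ⊗ (lit 10 ⊗ gap sm≤64 ⊕ lit 6528)) (eq e q s)
      where
      eq : ∀ e q s → e * e * e * q - (Q 1024 * (e * e * (e * e)) * q + Q 10 * (e * e * (e * e) * (e * e))
          * (q * q) * s) ≡
        e * e * q * e * (1ℚ - Q 8192 * e) + e * e * (e * e) * q * (Q 10 * (Q 64 - s * (e * e * q)) + Q 6528)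
      eq = solve-∀ ℚ-ring

    -- D + η ≤ 2g ≤ m/4096 ≤ M/32, so even at the end the envelope and its tolerance are a small
    -- part of M.
    m≤256l : m ≤ Q 256 * (M - D s - η)
    m≤256l = ≤-by (lit 2 ⊗ gap m≤ ⊕ gap 8192g≤m ⊕ lit 256 ⊗ gap D≤g ⊕ lit 256 ⊗ gap η≤g ⊕ lit 7680 ⊗ 0≤g)
        (eq M (D s) η g m)
      where
      eq : ∀ M D η g m → Q 256 * (M - D - η) - m ≡
        Q 2 * (Q 128 * M - m) + (m - Q 8192 * g) + Q 256 * (g - D) + Q 256 * (g - η) + Q 7680 * g
      eq = solve-∀ ℚ-ring

    32U≤m : Q 64 * M ≤ m → Q 32 * (M + D s + η) ≤ m
    32U≤m 64M≤m = *-cancelˡ-≤ (Q 2) (lit< 1)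
      (≤-by (gap 64M≤m ⊕ gap 8192g≤m ⊕ lit 64 ⊗ gap D≤g ⊕ lit 64 ⊗ gap η≤g ⊕ lit 8064 ⊗ 0≤g) (eq M (D s) η g m))
      where
      eq : ∀ M D η g m → Q 2 * m - Q 2 * (Q 32 * (M + D + η)) ≡
        (m - Q 64 * M) + (m - Q 8192 * g) + Q 64 * (g - D) + Q 64 * (g - η) + Q 8064 * g
      eq = solve-∀ ℚ-ring

    3≤2l : Q 3 ≤ Q 2 * (M - D s - η)
    3≤2l = *-cancelˡ-≤ (Q 128) (lit< 127) (≤-by (gap m≤256l ⊕ gap
        (big⇒ 384 big₂ (≤-by (lit 67108480) refl))) (eq (M - D s - η) m))
      where
      eq : ∀ l m → Q 128 * (Q 2 * l) - Q 128 * Q 3 ≡ Q 256 * l - m + (m - Q 384)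
      eq = solve-∀ ℚ-ring

    ≤κ : Q 2 * (D s * D s) + (Q 2 * η + Q 3) * (M + D s) ≤ κ
    ≤κ = ≤-by (lit 2 ⊗ (gap D≤g ⊗ (0≤g ⊕ 0≤D)) ⊕ (lit 2 ⊗ 0≤η ⊕ lit 3) ⊗ (gap M≤ ⊕ gap D≤g ⊕ gap g≤q)
        ⊕ 0≤q ⊗ (lit 2 ⊗ gap (subst (Q 67108864 ≤_) (ℚ.*-comm q e⁶) big) ⊕ lit 134217719)) (eq M (D s) q e)
      where
      eq : ∀ M D q e → Q 10 * (e * e * (e * e) * (e * e)) * (q * q) -
          (Q 2 * (D * D) + (Q 2 * (e * e * (e * e) * (e * e) * q) + Q 3) * (M + D)) ≡
        Q 2 * ((e * e * e * q - D) * (e * e * e * q + D))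
          + (Q 2 * (e * e * (e * e) * (e * e) * q) + Q 3) *
              (Q 2 * q - M + (e * e * e * q - D) + (q - e * e * e * q))
          + q * (Q 2 * (e * e * (e * e) * (e * e) * q - Q 67108864) + Q 134217719)
      eq = solve-∀ ℚ-ring

    -- This is `small-step` before division by #tri: the triangles number at least a constant times
    -- e⁴q³, the right side is of order q², and e⁴q is large. 65536 is 256², from `m≤256l`.
    6X≤T : ∀ {T} → Q n * ((M - D s - η) * (M - D s - η)) ≤ T → Q 6 * (Q 2 * (M * M) + κ) ≤ T
    6X≤T {T} ql²≤T = *-cancelˡ-≤ (Q 65536) (lit< 65535)
      (≤-by (lit 65536 ⊗ gap ql²≤T ⊕ 0≤q ⊗ gap (*-mono-≤ 0≤m 0≤m m≤256l m≤256l)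
          ⊕ lit 393216 ⊗ (lit 2 ⊗ (gap M≤ ⊗ (lit 2 ⊗ 0≤q ⊕ 0≤M)) ⊕ gap κ≤q²)
          ⊕ (0≤q ⊗ 0≤q) ⊗ gap (big⇒ 3538944 big₄ (≤-by (lit 63569920) refl)))
        (eq T M (M - D s - η) κ q e))
      where
      eq : ∀ T M l κ q e → Q 65536 * T - Q 65536 * (Q 6 * (Q 2 * (M * M) + κ)) ≡
        Q 65536 * (T - q * (l * l)) + q * (Q 256 * l * (Q 256 * l) - e * e * q * (e * e * q))
          + Q 393216 * (Q 2 * ((Q 2 * q - M) * (Q 2 * q + M)) + (q * q - κ))
          + q * q * (q * (e * e * (e * e)) - Q 3538944)
      eq = solve-∀ ℚ-ring

    growth*s≤ : growth * s ≤ q * q * (Θ * Θ * (Θ * Θ))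
    growth*s≤ = ≤-by ((0≤q ⊗ 0≤q ⊗ (0≤Θ ⊗ 0≤Θ ⊗ 0≤Θ)) ⊗ (lit 262144 ⊗ (0≤q ⊗ (0≤K ⊗ 0≤K ⊗ gap sm≤64))))
      (trans (eq₁ q Θ s K) (cong (q * q * (Θ * Θ * Θ) *_)
          (trans (eq₂ q s e K) (trans (cong (λ x → Q 262144 * (q * (K * K * (Q 64 - s * m))) + Q 262144 *
          (q * q * s) * (x * x - 1ℚ)) eK≡1) (eq₃ (Q 262144 * (q * (K * K * (Q 64 - s * m))))
          (Q 262144 * (q * q * s)))))))
      where
      0≤Θ = ℚ.≤-trans (lit 16) 16≤Θ
      eq₁ : ∀ q Θ s K → q * q * (Θ * Θ * (Θ * Θ)) - Q 262144 * (q * q * (q * q)) * (Θ * Θ * Θ) * s ≡ q * q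
          * (Θ * Θ * Θ) * (Θ - Q 262144 * (q * q * s))
      eq₁ = solve-∀ ℚ-ring
      eq₂ : ∀ q s e K → Q 16777216 * (q * (K * K)) - Q 262144 * (q * q * s) ≡
        Q 262144 * (q * (K * K * (Q 64 - s * (e * e * q)))) + Q 262144 * (q * q * s) * (e * K * (e * K) - 1ℚ)
      eq₂ = solve-∀ ℚ-ring
      eq₃ : ∀ x y → x + y * (1ℚ * 1ℚ - 1ℚ) ≡ x
      eq₃ = solve-∀ ℚ-ring

    scales : ∀ {T h} → Q n * ((M - D s - η) * (M - D s - η)) ≤ T → 0ℚ ≤ h → h * T ≡ Q 6 →
      Scales n M (D s) h κ η Θ (proj₁ Θ-inverse)
    scales {T} {h} ql²≤T 0≤h hT≡6 = record
      { 0≤M = 0≤M ; M≤ = M≤ ; 0≤D = 0≤D ; 0≤h = 0≤h ; 0≤κ = 0≤κ ; κ≤ = κ≤q² ; 0≤η = 0≤η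
      ; small-step = *-cancelˡ-≤ (Q 6) (lit< 5) (≤-by (0≤h ⊗ gap (6X≤T ql²≤T))
          (trans (cong (λ x → x * 1ℚ - Q 6 * (h * (Q 2 * (M * M) + κ))) (sym hT≡6))
              (eq h T (Q 2 * (M * M) + κ))))
      ; 3≤ = 3≤2l ; ≤κ = ≤κ ; 16≤Θ = 16≤Θ
      ; 0≤ψ = ℚ.<⇒≤ (proj₁ (proj₂ Θ-inverse)) ; Θψ≡1 = proj₂ (proj₂ Θ-inverse) }
      where
      eq : ∀ h T X → h * T * 1ℚ - Q 6 * (h * X) ≡ h * (T - Q 6 * X)
      eq = solve-∀ ℚ-ring

    -- As 4Mh ≤ 1, a step at most halves M; hence the run continues only while M ≥ m/64, and the
    -- invariant asks for m/128. For 2Ms ≤ 1 the new slack is (1 - 2Ms)(1 - 2Mh) + (2Mh)².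
    advance : ∀ {h} → 0ℚ ≤ h → h * (Q 2 * (M * M) + κ) ≤ 1ℚ → m ≤ Q 64 * M →
      Controlled (s + h) (M - Q 2 * (M * M) * h)
    advance {h} 0≤h small-step m≤64M = record
      { 0≤s = 0≤s ⊕ 0≤h
      ; 2Ms≤1 = ≤-by (gap 2Ms≤1 ⊗ 2Mh≤1 ⊕ 0≤sq (Q 2 * M * h)) (eq₁ M s h)
      ; m≤ = ≤-by (gap m≤64M ⊕ lit 64 ⊗ (0≤M ⊗ 4Mh≤1)) (eq₂ M h m)
      ; M≤ = ≤-by (gap M≤ ⊕ lit 2 ⊗ (0≤M ⊗ 0≤M) ⊗ 0≤h) (eq₃ q M h) }
      where
      eq₁ : ∀ M s h → 1ℚ - Q 2 * (M - Q 2 * (M * M) * h) * (s + h) ≡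
        (1ℚ - Q 2 * M * s) * (1ℚ - Q 2 * M * h) + Q 2 * M * h * (Q 2 * M * h)
      eq₁ = solve-∀ ℚ-ring
      eq₂ : ∀ M h m → Q 128 * (M - Q 2 * (M * M) * h) - m ≡ Q 64 * M - m + Q 64 * (M * (1ℚ - Q 4 * M * h))
      eq₂ = solve-∀ ℚ-ring
      eq₃ : ∀ q M h → Q 2 * q - (M - Q 2 * (M * M) * h) ≡ Q 2 * q - M + Q 2 * (M * M) * h
      eq₃ = solve-∀ ℚ-ring
      4Mh≤1 : 0ℚ ≤ 1ℚ - Q 4 * M * h
      4Mh≤1 = subst (0ℚ ≤_) (eq M h κ) (gap small-step ⊕ 0≤h ⊗ 0≤κ ⊕ lit 2 ⊗ 0≤M ⊗ 0≤h ⊗ gap 2≤M)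
        where
        eq : ∀ M h κ → 1ℚ - h * (Q 2 * (M * M) + κ) + h * κ + Q 2 * M * h * (M - Q 2) ≡ 1ℚ - Q 4 * M * h
        eq = solve-∀ ℚ-ring
      2Mh≤1 : 0ℚ ≤ 1ℚ - Q 2 * M * h
      2Mh≤1 = subst (0ℚ ≤_) (eq M h) (4Mh≤1 ⊕ lit 2 ⊗ 0≤M ⊗ 0≤h)
        where
        eq : ∀ M h → 1ℚ - Q 4 * M * h + Q 2 * M * h ≡ 1ℚ - Q 2 * M * h
        eq = solve-∀ ℚ-ring

  private
    eq-d : ∀ d l u e q → Q 1024 * (d * d * l - d * l) - Q 1024 * (q * (u * u) + d * d) ≡
      Q 4 * ((Q 256 * l - e * e * q) * (d * (d - 1ℚ)))
        + q * (e * e * q * (e * e * q) - Q 32 * u * (Q 32 * u))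
        + e * e * q * (d * d - e * q * (e * q))
        + d * (d * (e * e * q - Q 1024) + Q 2 * (e * e * q) * (d - Q 2))
    eq-d = solve-∀ ℚ-ring

    -- If d ≥ eq, then qu² ≤ qm²/1024 = m(eq)²/1024 ≤ md²/1024, while d²l ≥ md²/256. The factor 4
    -- between them leaves room for d² and dl.
    large-degree : ∀ {d l u} → m ≤ Q 256 * l → 0ℚ ≤ u → Q 32 * u ≤ m → e * q ≤ d →
      Q 67108864 ≤ d →
      q * (u * u) + d * d < d * d * l - d * l
    large-degree {d} {l} {u} m≤256l 0≤u 32u≤m eq≤d big-d = *-cancelˡ-< (Q 1024) (lit< 1023) contra
      where
      2<d : Q 2 < d
      2<d = ℚ.<-≤-trans (<-by (lit< 67108861) refl) big-d
      0<d : 0ℚ < d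
      0<d = ℚ.<-trans (lit< 1) 2<d
      0≤d : 0ℚ ≤ d
      0≤d = ℚ.<⇒≤ 0<d
      1≤d : 1ℚ ≤ d
      1≤d = ℚ.≤-trans (≤-by 0≤1 refl) (ℚ.<⇒≤ 2<d)
      0<m : 0ℚ < m
      0<m = ℚ.<-≤-trans (lit< 67108863) big₂
      t₁ = lit 4 ⊗ (gap m≤256l ⊗ (0≤d ⊗ gap 1≤d))
      t₂ = 0≤q ⊗ gap (*-mono-≤ (lit 32 ⊗ 0≤u) (lit 32 ⊗ 0≤u) 32u≤m 32u≤m)
      t₃ = 0≤m ⊗ gap (²-mono (0≤e ⊗ 0≤q) eq≤d)
      1024≤m : Q 1024 ≤ m
      1024≤m = big⇒ 1024 big₂ (≤-by (lit 67107840) refl)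
      t₄ : 0ℚ < d * (d * (m - Q 1024) + Q 2 * m * (d - Q 2))
      t₄ = 0<d ⊗< (0≤d ⊗ gap 1024≤m ⊕< lit< 1 ⊗< 0<m ⊗< gap< 2<d)
      contra : Q 1024 * (q * (u * u) + d * d) < Q 1024 * (d * d * l - d * l)
      contra = <-by (t₁ ⊕ t₂ ⊕ t₃ ⊕< t₄) (eq-d d l u e q)

  small-degree : ∀ {d l u} → m ≤ Q 256 * l → 0ℚ ≤ u → Q 32 * u ≤ m →
    d * d * l - d * l ≤ q * (u * u) + d * d → d < e * q
  small-degree m≤256l 0≤u 32u≤m bound = ℚ.≰⇒> λ eq≤d →
    ℚ.<-irrefl refl (ℚ.<-≤-trans (large-degree m≤256l 0≤u 32u≤m eq≤d (ℚ.≤-trans big₁ eq≤d)) bound)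

-- The removal process

Q-injective : ∀ {j k} → Q j ≡ Q k → j ≡ k
Q-injective j≡k = ℤ.+-injective (cong ℚ.numerator j≡k)

does-∈? : ∀ {n} (σ : Fin n → Bool) u → does (u ∈? tabulate σ) ≡ σ u
does-∈? σ u with σ u in σu
... | true  = dec-true (u ∈? tabulate σ) (lookup⇒[]= u (tabulate σ) (trans (lookup∘tabulate σ u) σu))
... | false = dec-false (u ∈? tabulate σ) λ u∈ → case trans (sym σu)
    (trans (sym (lookup∘tabulate σ u)) ([]=⇒lookup u∈)) of λ ()

∈tabulate⇒ : ∀ {n} (σ : Fin n → Bool) {u} → u ∈ tabulate σ → σ u ≡ true
∈tabulate⇒ σ {u} u∈ = trans (sym (lookup∘tabulate σ u)) ([]=⇒lookup u∈)

adj : ∀ {n} → Graph n → Fin n → Fin n → Bool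
adj H u v = does (adj? H u v)

module _ {n : ℕ} (H : Graph n) where

  adj-sym : ∀ u v → adj H u v ≡ adj H v u
  adj-sym u v = does-⇔ (mk⇔ (symm H) (symm H)) (adj? H u v) (adj? H v u)

  adj-irrefl : ∀ u → adj H u u ≡ false
  adj-irrefl u = dec-false (adj? H u u) (irrefl H refl)

  adj⇒Adj : ∀ {u v} → adj H u v ≡ true → Adj H u v
  adj⇒Adj {u} {v} uv with adj? H u v
  ... | yes a = a

  degree≡ : ∀ v → fromℕ (degree H v) ≡ deg (adj H) v
  degree≡ v = trans (fromℕ≡Q (degree H v)) (∣tabulate∣ (adj H v))

  codegree≡ : ∀ u v → fromℕ (codegree H u v) ≡ codeg (adj H) u v
  codegree≡ u v = trans (fromℕ≡Q (codegree H u v))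
      (trans (cong (λ S → Q ∣ S ∣) (tabulate-∩ (adj H u) (adj H v)))
    (trans (∣tabulate∣ λ w → adj H u w ∧ adj H v w) (∑-cong λ w → 𝟙-∧ (adj H u w) (adj H v w))))

module _ {n : ℕ} {α β : Fin n → Fin n → Bool} (α≡β : ∀ u v → α u v ≡ β u v) where

  codeg-cong : ∀ u v → codeg α u v ≡ codeg β u v
  codeg-cong u v = ∑-cong λ w → cong₂ (λ p q → 𝟙 p * 𝟙 q) (α≡β u w) (α≡β v w)

  Φ-cong : ∀ M D → Φ α M D ≡ Φ β M D
  Φ-cong M D = ∑-cong λ u → ∑-cong λ v → cong (λ c → distinct u v * (ψ⁸ (c - (M + D)) + ψ⁸ (M - D - c)))
      (codeg-cong u v)

module Removal {n : ℕ} (G : Graph n) (N : List (Subset n)) {x y z : Fin n} where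

  private
    H = G ∖⋃ N
  open Triangles (adj H) (adj-sym H) (adj-irrefl H) using (tri)
  open Loss (adj H) (adj-sym H) (adj-irrefl H) using (tri⇒; ∑corner)

  triangle : Subset n
  triangle = tabulate (corner? x y z)

  adj-removed : ∀ u v → remove (corner? x y z) (adj H) u v ≡ adj (G ∖⋃ (triangle ∷ N)) u v
  adj-removed u v = trans
    (boolean (adj G u v) (does (any? (λ T → (u ∈? T) ×-dec (v ∈? T)) N)) (corner? x y z u ∧ corner? x y z v))
    (cong (λ b → adj G u v ∧ not (b ∨ does (any? (λ T → (u ∈? T) ×-dec (v ∈? T)) N)))
      (sym (cong₂ _∧_ (does-∈? (corner? x y z) u) (does-∈? (corner? x y z) v))))
    where
    boolean : ∀ p q r → (p ∧ not q) ∧ not r ≡ p ∧ not (r ∨ q)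
    boolean false _     _     = refl
    boolean true  false false = refl
    boolean true  false true  = refl
    boolean true  true  false = refl
    boolean true  true  true  = refl

  corner-of : ∀ {u} → corner? x y z u ≡ true → x ≡ u ⊎ y ≡ u ⊎ z ≡ u
  corner-of {u} σu with x Fin.≟ u | y Fin.≟ u | z Fin.≟ u
  ... | yes x≡u | _       | _       = inj₁ x≡u
  ... | no _    | yes y≡u | _       = inj₂ (inj₁ y≡u)
  ... | no _    | no _    | yes z≡u = inj₂ (inj₂ z≡u)

  isTriangle : tri x y z ≡ true → IsTriangle H triangle
  isTriangle t with tri⇒ t
  ... | xy , yz , xz =
    Q-injective (trans (∣tabulate∣ (corner? x y z)) (∑corner t)) ,
    λ u∈ v∈ u≢v → edge (corner-of (∈tabulate⇒ (corner? x y z) u∈))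
        (corner-of (∈tabulate⇒ (corner? x y z) v∈)) u≢v
    where
    Axy = adj⇒Adj H xy
    Ayz = adj⇒Adj H yz
    Axz = adj⇒Adj H xz
    edge : ∀ {u v} → x ≡ u ⊎ y ≡ u ⊎ z ≡ u → x ≡ v ⊎ y ≡ v ⊎ z ≡ v → u ≢ v → Adj H u v
    edge (inj₁ refl)        (inj₁ refl)        u≢v = contradiction refl u≢v
    edge (inj₁ refl)        (inj₂ (inj₁ refl)) _   = Axy
    edge (inj₁ refl)        (inj₂ (inj₂ refl)) _   = Axz
    edge (inj₂ (inj₁ refl)) (inj₁ refl)        _   = symm H Axy
    edge (inj₂ (inj₁ refl)) (inj₂ (inj₁ refl)) u≢v = contradiction refl u≢v
    edge (inj₂ (inj₁ refl)) (inj₂ (inj₂ refl)) _   = Ayz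
    edge (inj₂ (inj₂ refl)) (inj₁ refl)        _   = symm H Axz
    edge (inj₂ (inj₂ refl)) (inj₂ (inj₁ refl)) _   = symm H Ayz
    edge (inj₂ (inj₂ refl)) (inj₂ (inj₂ refl)) u≢v = contradiction refl u≢v

  -- An edge of the remaining graph is covered by no earlier triangle, so a pair shared with one
  -- would be a contradiction.
  extend-packing : tri x y z ≡ true → EdgeDisjointTriangles G N → EdgeDisjointTriangles G (triangle ∷ N)
  extend-packing t (triangles , disjoint) =
    let three , clique = isTriangle t in
    ((three , λ u∈ v∈ u≢v → proj₁ (clique u∈ v∈ u≢v)) ∷ triangles) ,
    (All.tabulate (λ S∈N u≢v ((u∈T , v∈T) , (u∈S , v∈S)) →
        proj₂ (clique u∈T v∈T u≢v) (lose S∈N (u∈S , v∈S)))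
      ∷ disjoint)

module Process {n : ℕ} {e K : ℚ} (0<e : 0ℚ < e) (eK≡1 : e * K ≡ 1ℚ)
  (small : Q 8192 * e ≤ 1ℚ) (large : 1ℚ ≤ Q n * (e ⁸ ² ²)) (G : Graph n) where

  open Parameters {n} 0<e eK≡1 small large
  open Envelope {n} 0<e eK≡1 small large

  State : List (Subset n) → (s M : ℚ) → Set
  State N s M = EdgeDisjointTriangles G N × Controlled s M × Φ (adj (G ∖⋃ N)) M (D s) ≤ growth * s

  other : ∀ (u : Fin n) → ∃[ v ] u ≢ v
  other = second n (big⇒ 2 big₀ (≤-by (lit 67108862) refl))
    where
    second : ∀ k → Q 2 ≤ Q k → ∀ (u : Fin k) → ∃[ v ] u ≢ v
    second (suc zero) 2≤1 _ = contradiction 2≤1 (toWitnessFalse {a? = Q 2 ℚ.≤? Q 1} _)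
    second (suc (suc k)) _ zero    = suc zero , λ ()
    second (suc (suc k)) _ (suc u) = zero , λ ()

  module _ {N : List (Subset n)} {s M : ℚ} (state : State N s M) where
    private
      packing    = proj₁ state
      controlled = proj₁ (proj₂ state)
      Φ≤         = proj₂ (proj₂ state)
      α = adj (G ∖⋃ N)
      α-sym = adj-sym (G ∖⋃ N)
      α-irrefl = adj-irrefl (G ∖⋃ N)
      open Triangles α α-sym α-irrefl using (#tri; c)
      open Count α α-sym α-irrefl

      Φ≤cap : Φ α M (D s) ≤ q * q * (Θ * Θ * (Θ * Θ))
      Φ≤cap = ℚ.≤-trans Φ≤ (growth*s≤ controlled)

      Φ<η⁸ : Φ α M (D s) < η ⁸
      Φ<η⁸ = ℚ.≤-<-trans Φ≤cap Θ⁴<η⁸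

      c≤ : ∀ {u v} → u ≢ v → c u v ≤ M + D s + η
      c≤ = Φ<⇒≤ α {M} {D s} 0≤η Φ<η⁸

      ≤c : ∀ {u v} → u ≢ v → M - D s - η ≤ c u v
      ≤c = Φ<⇒≥ α {M} {D s} 0≤η Φ<η⁸

      0≤l : 0ℚ ≤ M - D s - η
      0≤l = *-cancelˡ-≤ (Q 256) (lit< 255) (subst (_≤ Q 256 * (M - D s - η)) (sym (ℚ.*-zeroʳ (Q 256)))
          (ℚ.≤-trans 0≤m (m≤256l controlled)))

      ql²≤#tri : Q n * ((M - D s - η) * (M - D s - η)) ≤ #tri
      ql²≤#tri = nl²≤#tri 0≤l ≤c other

      0<#tri : 0ℚ < #tri
      0<#tri = ℚ.<-≤-trans (lit< 5 ⊗< 0<X) (6X≤T controlled ql²≤#tri)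
        where
        0<X : 0ℚ < Q 2 * (M * M) + κ
        0<X = subst (0ℚ <_) (ℚ.+-comm κ (Q 2 * (M * M))) (0≤κ ⊕< lit< 1 ⊗< (0<M ⊗< 0<M))
          where 0<M = ℚ.<-≤-trans (lit< 1) (2≤M controlled)

    advance-state : m ≤ Q 64 * M → Σ[ N′ ∈ List (Subset n) ] ∃[ s′ ] ∃[ M′ ]
      State N′ s′ M′ × 1ℚ + s * (q * (q * q)) ≤ s′ * (q * (q * q))
    advance-state m≤64M =
      let x , y , z , t , Φ′< = good-triangle 0<q Φ≤cap
          open Removal G N {x} {y} {z}
      in triangle ∷ N , s + h , M′ ,
        ( extend-packing t packing
        , advance controlled 0≤h (Scales.small-step sc) m≤64M
        , subst (_≤ growth * (s + h))
            (trans (Φ-cong adj-removed M′ D′) (cong (Φ (adj (G ∖⋃ (triangle ∷ N))) M′)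
                (D+ (Q 1024 * (e ² * e ²) * q) κ s h)))
            (ℚ.≤-trans (ℚ.<⇒≤ Φ′<) (≤-by (gap Φ≤) (eq₁ growth s h (Φ α M (D s)))))
        ) , progress
      where
      inv = inverse 0<#tri
      h = Q 6 * proj₁ inv
      0≤h : 0ℚ ≤ h
      0≤h = lit 6 ⊗ ℚ.<⇒≤ (proj₁ (proj₂ inv))
      h-def : h * #tri ≡ Q 6
      h-def = trans (eq (proj₁ inv) #tri) (trans (cong (Q 6 *_) (proj₂ (proj₂ inv))) (ℚ.*-identityʳ (Q 6)))
        where
        eq : ∀ i T → Q 6 * i * T ≡ Q 6 * (T * i)
        eq = solve-∀ ℚ-ring
      sc = scales controlled ql²≤#tri 0≤h h-def
      open Step α α-sym α-irrefl sc h-def 0<#tri c≤ ≤c using (good-triangle; M′; D′)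
      D+ : ∀ d κ s h → d + κ * s + κ * h ≡ d + κ * (s + h)
      D+ = solve-∀ ℚ-ring
      eq₁ : ∀ g s h p → g * (s + h) - (p + g * h) ≡ g * s - p
      eq₁ = solve-∀ ℚ-ring
      progress : 1ℚ + s * (q * (q * q)) ≤ (s + h) * (q * (q * q))
      progress = ≤-by (0≤h ⊗ gap #tri≤n³ ⊕ lit 5) (trans (eq₂ s h q #tri)
          (cong (λ x → h * (q * (q * q) - #tri) + (x - 1ℚ)) h-def))
        where
        eq₂ : ∀ s h q T → (s + h) * (q * (q * q)) - (1ℚ + s * (q * (q * q))) ≡ h * (q * (q * q) - T) +
            (h * T - 1ℚ)
        eq₂ = solve-∀ ℚ-ring

    final-degree : Q 64 * M ≤ m → ∀ v → deg α v < e * q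
    final-degree 64M≤m v = small-degree (m≤256l controlled) 0≤U (32U≤m controlled 64M≤m)
      (deg²-bound 0≤l 0≤U ≤c c≤ v)
      where
      0≤U : 0ℚ ≤ M + D s + η
      0≤U = 0≤M controlled ⊕ 0≤D controlled ⊕ 0≤η

  -- Termination is measured by sq³: a step adds hq³ ≥ h · #tri = 6, of which 1 is recorded, and sm
  -- ≤ 64 caps the total at 64q²K². The last hypothesis says that the fuel outlasts this cap.
  run : ∀ fuel {N s M} → State N s M → Q 64 * (q * q * (K * K)) < Q fuel + s * (q * (q * q)) →
    Σ[ N′ ∈ List (Subset n) ] EdgeDisjointTriangles G N′ × (∀ v → deg (adj (G ∖⋃ N′)) v < e * q)
  continue : ∀ fuel {N s M} → Q 64 * M ≤ m ⊎ m ≤ Q 64 * M → State N s M →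
    Q 64 * (q * q * (K * K)) < Q fuel + s * (q * (q * q)) →
    Σ[ N′ ∈ List (Subset n) ] EdgeDisjointTriangles G N′ × (∀ v → deg (adj (G ∖⋃ N′)) v < e * q)
  run fuel {M = M} = continue fuel (ℚ.≤-total (Q 64 * M) m)
  continue fuel {N} (inj₁ 64M≤m) state _ = N , proj₁ state , final-degree state 64M≤m
  continue zero {N} {s} (inj₂ _) state enough = contradiction (ℚ.<-≤-trans enough exhausted) (ℚ.<-irrefl refl)
    where
    eq₁ : ∀ q K s e → Q 64 * (q * q * (K * K)) - (0ℚ + s * (q * (q * q))) ≡
      q * q * (K * K) * (Q 64 - s * (e * e * q)) + q * q * q * s * (e * K * (e * K) - 1ℚ)
    eq₁ = solve-∀ ℚ-ring
    eq₂ : ∀ x y → x + y * (1ℚ * 1ℚ - 1ℚ) ≡ x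
    eq₂ = solve-∀ ℚ-ring
    exhausted : Q 0 + s * (q * (q * q)) ≤ Q 64 * (q * q * (K * K))
    exhausted = ≤-by ((0≤q ⊗ 0≤q ⊗ (0≤K ⊗ 0≤K)) ⊗ gap (sm≤64 (proj₁ (proj₂ state))))
      (trans (eq₁ q K s e) (trans (cong (λ x → q * q * (K * K) * (Q 64 - s * m) + q * q * q * s *
          (x * x - 1ℚ)) eK≡1)
        (eq₂ (q * q * (K * K) * (Q 64 - s * m)) (q * q * q * s))))
  continue (suc fuel) {N} {s} (inj₂ m≤64M) state enough =
    let N′ , s′ , M′ , state′ , progress = advance-state state m≤64M
    in run fuel state′ (ℚ.<-≤-trans enough (≤-by (gap progress)
         (trans (cong (λ f → Q fuel + s′ * (q * (q * q)) - (f + s * (q * (q * q)))) (Q-suc fuel))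
           (eq (Q fuel) (s * (q * (q * q))) (s′ * (q * (q * q)))))))
    where
    eq : ∀ f a b → f + b - (1ℚ + f + a) ≡ b - (1ℚ + a)
    eq = solve-∀ ℚ-ring

  result : ∀ {M₀} → m ≤ Q 128 * M₀ → M₀ ≤ Q 2 * q →
    (∀ {u v} → u ≢ v → M₀ - D 0ℚ ≤ codeg (adj (G ∖⋃ [])) u v × codeg (adj (G ∖⋃ [])) u v ≤ M₀ + D 0ℚ) →
    Σ[ N ∈ List (Subset n) ] EdgeDisjointTriangles G N × (∀ v → deg (adj (G ∖⋃ N)) v < e * q)
  result {M₀} m≤128M₀ M₀≤2q within =
    let fuel , ≤fuel = archimedean (Q 64 * (q * q * (K * K)) + 1ℚ)
    in run fuel {[]} {0ℚ} {M₀}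
      ( ([] , [])
      , record { 0≤s = ℚ.≤-refl ; 2Ms≤1 = subst (_≤ 1ℚ) (sym (ℚ.*-zeroʳ (Q 2 * M₀))) 0≤1 ; m≤ = m≤128M₀ ;
          M≤ = M₀≤2q }
      , ℚ.≤-trans (Φ≤0 (adj (G ∖⋃ [])) {M₀} {D 0ℚ} within) (ℚ.≤-reflexive (sym (ℚ.*-zeroʳ growth))) )
      (<-by (gap ≤fuel ⊕< lit< 0) (eq (Q fuel) (Q 64 * (q * q * (K * K))) (q * (q * q))))
    where
    eq : ∀ f x y → f + 0ℚ * y - x ≡ f - (x + 1ℚ) + 1ℚ
    eq = solve-∀ ℚ-ring

-- Cuts

U-≤ : ∀ (b : ℝ) {p q} → p ≤ q → U b p → U b q
U-≤ b p≤q Up = let r , r<p , Ur = U-rounded b Up in U-closed b (ℚ.<-≤-trans r<p p≤q) Ur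

L<U : ∀ (b : ℝ) {p q} → L b p → U b q → p < q
L<U b Lp Uq = ℚ.≰⇒> λ q≤p → disjoint b Lp (U-≤ b q≤p Uq)

-- `e` stands in for b^(1/4). The lower cut says 2e < b^(1/4), so degrees below en are small enough;
-- the upper cut makes 512e⁴ an admissible relative error in typicality. The factor 32 between the
-- cuts is 16 from halving e and 2 from locatedness.
Scale : ℝ → Set
Scale b = ∃[ e ] ∃[ K ] 0ℚ < e × e * K ≡ 1ℚ × Q 8192 * e ≤ 1ℚ
  × L b (Q 16 * (e ² * e ²)) × U b (Q 512 * (e ² * e ²))

½ : ℚ
½ = ratio 1 2

-- Halving e until 16 e⁴ drops below b determines the power of two next to b^(1/4).
Guess : ℝ → (e K : ℚ) → Set
Guess b e K = 0ℚ < e × e * K ≡ 1ℚ × 1ℚ ≤ K × Q 4096 * e ≤ 1ℚ × U b (Q 32 * (e ² * e ²))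

-- With e′ = e/2, locatedness of b between 16e′⁴ and 32e′⁴ decides: either the lower cut of `Scale`
-- holds and the old bound 32e⁴ = 512e′⁴ is its upper cut, or b < 32e′⁴ is the next guess.
halve : ∀ b {e K} → Guess b e K → Scale b ⊎ Guess b (½ * e) (Q 2 * K)
halve b {e} {K} (0<e , eK≡1 , 1≤K , small , Ue) = Sum.map
  (λ below → ½ * e , Q 2 * K , 0<e′ , e′K′≡1 , ≤-by (gap small) (eq₂ e) , below , subst (U b) (eq₃ e) Ue)
  (λ above → 0<e′ , e′K′≡1 , ≤-by (lit 2 ⊗ gap 1≤K ⊕ 0≤1) (eq₄ K) , ≤-by
      (gap small ⊕ lit 2048 ⊗ ℚ.<⇒≤ 0<e) (eq₅ e) , above)
  (located b (<-by (lit< 15 ⊗< (0<e′ ⊗< 0<e′ ⊗< (0<e′ ⊗< 0<e′))) (eq₆ (½ * e))))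
  where
  0<e′ : 0ℚ < ½ * e
  0<e′ = ℚ.positive⁻¹ ½ ⊗< 0<e
  eq₁ : ∀ e K → ½ * e * (Q 2 * K) ≡ e * K
  eq₁ = solve-∀ ℚ-ring
  e′K′≡1 : ½ * e * (Q 2 * K) ≡ 1ℚ
  e′K′≡1 = trans (eq₁ e K) eK≡1
  eq₂ : ∀ e → 1ℚ - Q 8192 * (½ * e) ≡ 1ℚ - Q 4096 * e
  eq₂ = solve-∀ ℚ-ring
  eq₃ : ∀ e → Q 32 * (e * e * (e * e)) ≡ Q 512 * (½ * e * (½ * e) * (½ * e * (½ * e)))
  eq₃ = solve-∀ ℚ-ring
  eq₄ : ∀ K → Q 2 * K - 1ℚ ≡ Q 2 * (K - 1ℚ) + 1ℚ
  eq₄ = solve-∀ ℚ-ring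
  eq₅ : ∀ e → 1ℚ - Q 4096 * (½ * e) ≡ 1ℚ - Q 4096 * e + Q 2048 * e
  eq₅ = solve-∀ ℚ-ring
  eq₆ : ∀ e → Q 32 * (e * e * (e * e)) - Q 16 * (e * e * (e * e)) ≡ Q 16 * (e * e * (e * e))
  eq₆ = solve-∀ ℚ-ring

-- p < b < 32e⁴ ≤ 32e, so K = 1/e cannot double forever.
guess-bounded : ∀ b {p e K} → 0ℚ < p → L b p → Guess b e K → K * p < Q 32
guess-bounded b {p} {e} {K} 0<p Lp (0<e , eK≡1 , 1≤K , small , Ue) = *-cancelˡ-< e 0<e
  (<-by (lit 32 ⊗ (0≤e ⊗ gap e³≤1) ⊕< gap< (L<U b Lp Ue)) (trans (eq₁ p e K)
    (trans (cong (λ x → Q 32 * (e * (1ℚ - e * e * e)) + (Q 32 * (e * e * (e * e)) - p) + (1ℚ - x) * p) eK≡1)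
      (eq₂ (Q 32 * (e * (1ℚ - e * e * e)) + (Q 32 * (e * e * (e * e)) - p)) p))))
  where
  0≤e = ℚ.<⇒≤ 0<e
  e≤1 : e ≤ 1ℚ
  e≤1 = ≤-by (gap small ⊕ lit 4095 ⊗ 0≤e) (eq e)
    where
    eq : ∀ e → 1ℚ - e ≡ (1ℚ - Q 4096 * e) + Q 4095 * e
    eq = solve-∀ ℚ-ring
  e³≤1 : e * e * e ≤ 1ℚ
  e³≤1 = *-mono-≤ {q = 1ℚ} {s = 1ℚ} (0≤sq e) 0≤e (pow-≤1 0≤e e≤1) e≤1
  eq₁ : ∀ p e K → e * Q 32 - e * (K * p) ≡
    Q 32 * (e * (1ℚ - e * e * e)) + (Q 32 * (e * e * (e * e)) - p) + (1ℚ - e * K) * p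
  eq₁ = solve-∀ ℚ-ring
  eq₂ : ∀ x p → x + (1ℚ - 1ℚ) * p ≡ x
  eq₂ = solve-∀ ℚ-ring

-- Doubling K ≥ 1 adds at least 1, so `F ≤ Q fuel + K` is kept while fuel drops. At zero fuel Kp ≥
-- Fp ≥ 32 contradicts `guess-bounded`.
find-scale : ∀ b {p F} → 0ℚ < p → L b p → Q 32 ≤ F * p → ∀ fuel {e K} → F ≤ Q fuel + K → Guess b e K → Scale b
find-scale b {p} {F} 0<p Lp 32≤Fp zero {e} {K} F≤K guess = contradiction (guess-bounded b 0<p Lp guess)
  λ Kp<32 → ℚ.<-irrefl refl (ℚ.<-≤-trans Kp<32 (ℚ.≤-trans 32≤Fp
    (≤-by (gap F≤K ⊗ ℚ.<⇒≤ 0<p) (eq F p K))))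
  where
  eq : ∀ F p K → K * p - F * p ≡ (0ℚ + K - F) * p
  eq = solve-∀ ℚ-ring
find-scale b {F = F} 0<p Lp 32≤Fp (suc fuel) {e} {K} F≤ guess@(_ , _ , 1≤K , _) =
  [ id , find-scale b 0<p Lp 32≤Fp fuel F≤′ ]′ (halve b guess)
  where
  eq : ∀ f K F → f + Q 2 * K - F ≡ 1ℚ + f + K - F + (K - 1ℚ)
  eq = solve-∀ ℚ-ring
  F≤′ : F ≤ Q fuel + Q 2 * K
  F≤′ = ≤-by (gap F≤ ⊕ gap 1≤K) (trans (eq (Q fuel) K F) (cong (λ x → x + K - F + (K - 1ℚ)) (sym (Q-suc fuel))))

^-mono-≤ : ∀ k {r s} → 0ℚ ≤ r → r ≤ s → 0ℚ ≤ r ^ k × r ^ k ≤ s ^ k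
^-mono-≤ zero    0≤r r≤s = 0≤1 , ℚ.≤-refl
^-mono-≤ (suc k) 0≤r r≤s = let 0≤rᵏ , rᵏ≤sᵏ = ^-mono-≤ k 0≤r r≤s in 0≤r ⊗ 0≤rᵏ , *-mono-≤ 0≤r 0≤rᵏ r≤s rᵏ≤sᵏ

n*ratio≡1 : ∀ k → Q (suc k) * ratio 1 (suc k) ≡ 1ℚ
n*ratio≡1 k = trans
  (cong (Q (suc k) *_) (ℚ.normalize-coprime (1-coprimeTo (suc k))))
  (ℚ.*-inverseʳ (Q (suc k)))

private
  module _ {N e : ℚ} (0≤N : 0ℚ ≤ N) (0≤e : 0ℚ ≤ e) (small : Q 8192 * e ≤ 1ℚ) where

    16384w≤1 : Q 16384 * (Q 1237940039285380274899124224 * e ⁸) ≤ 1ℚ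
    16384w≤1 = subst (_≤ 1ℚ) (eq e) (pow-≤1 (0≤sq ((Q 8192 * e) ²))
        (pow-≤1 (0≤sq (Q 8192 * e)) (pow-≤1 (lit 8192 ⊗ 0≤e) small)))
      where
      eq : ∀ e → ((Q 8192 * e) * (Q 8192 * e) * ((Q 8192 * e) * (Q 8192 * e)) *
          ((Q 8192 * e) * (Q 8192 * e) * ((Q 8192 * e) * (Q 8192 * e)))) ≡ Q 16384 *
          (Q 1237940039285380274899124224 * (e * e * (e * e) * (e * e * (e * e))))
      eq = solve-∀ ℚ-ring

    -- 512¹⁰ = 2⁹⁰, so the tenth power is 2⁹⁰e⁴⁰, and 2⁹⁰e⁸ ≤ 2⁻¹⁴ because (8192e)⁸ = 2¹⁰⁴e⁸ ≤ 1.
    -- The eight spare powers of e absorb the constant.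
    s¹⁰≤e³² : N * (Q 512 * (e ² * e ²)) ^ 10 ≤ N * (e ⁸ ² ²)
    s¹⁰≤e³² = ≤-by ((0≤N ⊗ 0≤sq (e ⁸ ²)) ⊗ (gap 16384w≤1 ⊕ lit 16383 ⊗
        (lit 1237940039285380274899124224 ⊗ 0≤⁸ e))) (eq N e)
      where
      eq : ∀ n e → n * ((e * e * (e * e) * (e * e * (e * e))) * (e * e * (e * e) * (e * e * (e * e))) *
          ((e * e * (e * e) * (e * e * (e * e))) * (e * e * (e * e) * (e * e * (e * e))))) - n *
          ((Q 512 * (e * e * (e * e))) * ((Q 512 * (e * e * (e * e))) *
          ((Q 512 * (e * e * (e * e))) * ((Q 512 * (e * e * (e * e))) *
          ((Q 512 * (e * e * (e * e))) * ((Q 512 * (e * e * (e * e))) *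
          ((Q 512 * (e * e * (e * e))) * ((Q 512 * (e * e * (e * e))) *
          ((Q 512 * (e * e * (e * e))) * ((Q 512 * (e * e * (e * e))) * 1ℚ)))))))))) ≡
        n * ((e * e * (e * e) * (e * e * (e * e))) * (e * e * (e * e) * (e * e * (e * e))) *
            ((e * e * (e * e) * (e * e * (e * e))) * (e * e * (e * e) * (e * e * (e * e))))) *
            (1ℚ - Q 16384 * (Q 1237940039285380274899124224 * (e * e * (e * e) * (e * e * (e * e)))) + Q
            16383 * (Q 1237940039285380274899124224 * (e * e * (e * e) * (e * e * (e * e)))))
      eq = solve-∀ ℚ-ring

large-n : ∀ {k e r} → 0ℚ ≤ e → Q 8192 * e ≤ 1ℚ → 0ℚ < r → r < Q 512 * (e ² * e ²) → ratio 1 (suc k) < r ^ 10 →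
  1ℚ ≤ Q (suc k) * (e ⁸ ² ²)
large-n {k} {e} {r} 0≤e small 0<r r<s 1/n<r¹⁰ = ℚ.≤-trans 1≤ns¹⁰ (s¹⁰≤e³² {Q (suc k)} (lit (suc k)) 0≤e small)
  where
  1/n≤s¹⁰ : ratio 1 (suc k) ≤ (Q 512 * (e ² * e ²)) ^ 10
  1/n≤s¹⁰ = ℚ.≤-trans (ℚ.<⇒≤ 1/n<r¹⁰) (proj₂ (^-mono-≤ 10 (ℚ.<⇒≤ 0<r) (ℚ.<⇒≤ r<s)))
  1≤ns¹⁰ : 1ℚ ≤ Q (suc k) * (Q 512 * (e ² * e ²)) ^ 10
  1≤ns¹⁰ = ℚ.≤-trans (ℚ.≤-reflexive (sym (n*ratio≡1 k))) (*-monoˡ-≤ (Q (suc k)) (lit (suc k)) 1/n≤s¹⁰)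

adj-∖[] : ∀ {n} (G : Graph n) u v → adj (G ∖⋃ []) u v ≡ adj G u v
adj-∖[] G u v = ∧-identityʳ (adj G u v)

-- Sparse and dense graphs

module SparseOrDense {n : ℕ} {e K : ℚ} (0<e : 0ℚ < e) (eK≡1 : e * K ≡ 1ℚ)
  (small : Q 8192 * e ≤ 1ℚ) (large : 1ℚ ≤ Q n * (e ⁸ ² ²)) (G : Graph n)
  {d : ℚ} (0≤d : 0ℚ ≤ d) where

  open Parameters {n} 0<e eK≡1 small large
  open Process {n} 0<e eK≡1 small large G

  private
    ρ M₀ : ℚ
    ρ = Q 512 * (e ² * e ²)
    M₀ = d * d * q

    0≤M₀ : 0ℚ ≤ M₀
    0≤M₀ = 0≤d ⊗ 0≤d ⊗ 0≤q

    0≤ρ : 0ℚ ≤ ρ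
    0≤ρ = lit 512 ⊗ (0≤sq e ⊗ 0≤sq e)

    8ρ≤1 : Q 8 * ρ ≤ 1ℚ
    8ρ≤1 = ≤-by (gap small ⊕ lit 4096 ⊗ (0≤e ⊗ gap e³≤1) ⊕ lit 4096 ⊗ 0≤e) (eq e)
      where
      e³≤1 : e * e * e ≤ 1ℚ
      e³≤1 = *-mono-≤ {q = 1ℚ} {s = 1ℚ} (0≤sq e) 0≤e (pow-≤1 0≤e e≤1) e≤1
      eq : ∀ e → 1ℚ - Q 8 * (Q 512 * (e * e * (e * e))) ≡ 1ℚ - Q 8192 * e + Q 4096 *
          (e * (1ℚ - e * e * e)) + Q 4096 * e
      eq = solve-∀ ℚ-ring

  -- The empty packing works: degrees are at most (1 + ρ)en/8, and ρ ≤ 1/8.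
  sparse : Q 8 * d ≤ e → (∀ v → fromℕ (degree G v) ≤ (1ℚ + ρ) * (d * q)) → ∀ v → deg (adj (G ∖⋃ [])) v < e * q
  sparse 8d≤e deg≤ v = subst (_< e * q)
    (trans (degree≡ G v) (∑-cong λ w → cong 𝟙 (sym (adj-∖[] G v w))))
    (ℚ.≤-<-trans (deg≤ v) (*-cancelˡ-< (Q 8) (lit< 7) (<-by
      (gap 8ρ≤1 ⊗ (0≤d ⊗ 0≤q) ⊕ lit 2 ⊗ (gap 8d≤e ⊗ 0≤q) ⊕ lit 7 ⊗ (0≤d ⊗ 0≤q) ⊕< lit< 5 ⊗< (0<e ⊗< 0<q))
      (eq d ρ e q))))
    where
    eq : ∀ d ρ e q → Q 8 * (e * q) - Q 8 * ((1ℚ + ρ) * (d * q)) ≡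
      (1ℚ - Q 8 * ρ) * (d * q) + Q 2 * ((e - Q 8 * d) * q) + Q 7 * (d * q) + Q 6 * (e * q)
    eq = solve-∀ ℚ-ring

  dense : e ≤ Q 8 * d →
    (∀ u v → u ≢ v → (1ℚ - ρ) * M₀ ≤ fromℕ (codegree G u v) × fromℕ (codegree G u v) ≤ (1ℚ + ρ) * M₀) →
    Fin n →
    Σ[ N ∈ List (Subset n) ] EdgeDisjointTriangles G N × (∀ v → deg (adj (G ∖⋃ N)) v < e * q)
  dense e≤8d typical u₀ = result {M₀} m≤ M₀≤2q within
    where
    m≤ : m ≤ Q 128 * M₀
    m≤ = ≤-by (gap (²-mono 0≤e e≤8d) ⊗ 0≤q ⊕ lit 64 ⊗ 0≤M₀) (eq e d q)
      where
      eq : ∀ e d q → Q 128 * (d * d * q) - e * e * q ≡ (Q 8 * d * (Q 8 * d) - e * e) * q + Q 64 * (d * d * q)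
      eq = solve-∀ ℚ-ring
    codeg≡ : ∀ u v → fromℕ (codegree G u v) ≡ codeg (adj (G ∖⋃ [])) u v
    codeg≡ u v = trans (codegree≡ G u v) (codeg-cong (λ w x → sym (adj-∖[] G w x)) u v)
    lo : ∀ {u v} → u ≢ v → (1ℚ - ρ) * M₀ ≤ codeg (adj (G ∖⋃ [])) u v
    lo {u} {v} u≢v = subst ((1ℚ - ρ) * M₀ ≤_) (codeg≡ u v) (proj₁ (typical u v u≢v))
    hi : ∀ {u v} → u ≢ v → codeg (adj (G ∖⋃ [])) u v ≤ (1ℚ + ρ) * M₀
    hi {u} {v} u≢v = subst (_≤ (1ℚ + ρ) * M₀) (codeg≡ u v) (proj₂ (typical u v u≢v))
    -- Instead of bounding the density by 1, one codegree, at most n, is compared with (1 - ρ)M₀.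
    -- This is where a vertex `u₀` is required.
    M₀≤2q : M₀ ≤ Q 2 * q
    M₀≤2q = *-cancelˡ-≤ (Q 4) (lit< 3) (≤-by
      (lit 8 ⊗ gap (ℚ.≤-trans (lo (proj₂ (other u₀)))
          (Loss.c≤n (adj (G ∖⋃ [])) (adj-sym (G ∖⋃ [])) (adj-irrefl (G ∖⋃ [])) u₀ (proj₁ (other u₀))))
        ⊕ gap 8ρ≤1 ⊗ 0≤M₀ ⊕ lit 3 ⊗ 0≤M₀) (eq ρ M₀ q))
      where
      eq : ∀ ρ M q → Q 4 * (Q 2 * q) - Q 4 * M ≡ Q 8 * (q - (1ℚ - ρ) * M) + (1ℚ - Q 8 * ρ) * M + Q 3 * M
      eq = solve-∀ ℚ-ring
    ρM₀≤D : ρ * M₀ ≤ D 0ℚ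
    ρM₀≤D = ≤-by (0≤ρ ⊗ gap M₀≤2q) (eq e q M₀ κ)
      where
      eq : ∀ e q M κ → Q 1024 * (e * e * (e * e)) * q + κ * 0ℚ - Q 512 * (e * e * (e * e)) * M ≡ Q 512 *
          (e * e * (e * e)) * (Q 2 * q - M)
      eq = solve-∀ ℚ-ring
    within : ∀ {u v} → u ≢ v → M₀ - D 0ℚ ≤ codeg (adj (G ∖⋃ [])) u v × codeg (adj (G ∖⋃ [])) u v ≤ M₀ + D 0ℚ
    within u≢v =
      ℚ.≤-trans (≤-by (gap ρM₀≤D) (eq₁ ρ M₀ (D 0ℚ))) (lo u≢v) ,
      ℚ.≤-trans (hi u≢v) (≤-by (gap ρM₀≤D) (eq₂ ρ M₀ (D 0ℚ)))
      where
      eq₁ : ∀ ρ M D → (1ℚ - ρ) * M - (M - D) ≡ D - ρ * M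
      eq₁ = solve-∀ ℚ-ring
      eq₂ : ∀ ρ M D → M + D - (1ℚ + ρ) * M ≡ D - ρ * M
      eq₂ = solve-∀ ℚ-ring

root₄-above : ∀ (b : ℝ) {e} → 0ℚ < e → L b (Q 16 * (e ² * e ²)) → L (root 4 b) e
-- 16e⁴ = (2e)⁴, so 2e is a point of the lower cut strictly above e, as the cut of `root` demands.
root₄-above b {e} 0<e below = Q 2 * e , <-by 0<e (eq₁ e) , inj₂ (subst (L b) (eq₂ e) below)
  where
  eq₁ : ∀ e → Q 2 * e - e ≡ e
  eq₁ = solve-∀ ℚ-ring
  eq₂ : ∀ e → Q 16 * (e * e * (e * e)) ≡ Q 2 * e * (Q 2 * e * (Q 2 * e * (Q 2 * e * 1ℚ)))
  eq₂ = solve-∀ ℚ-ring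

module _ {n : ℕ} (b : ℝ) (G : Graph n) {r p : ℚ} (0<r : 0ℚ < r) (r<p : r < p) (1/n<r¹⁰ : ratio 1 n < r ^ 10)
  (Lp : L b p) (typical : Typical b G) (b<d : b <ᵣ fromℚ (density G)) where

  nearly-decompose : Fin n → Scale b →
    Σ[ N ∈ List (Subset n) ] (EdgeDisjointTriangles G N × Bounded (root 4 b) (G ∖⋃ N))
  nearly-decompose u₀ (e , K , 0<e , eK≡1 , small , below , above) =
    let N , packing , bound = [ sparse-case , dense-case ]′ (ℚ.≤-total (Q 8 * density G) e)
    in N , packing , λ v → e , root₄-above b 0<e below , subst₂ _<_ (sym (degree≡ (G ∖⋃ N) v))
        (cong (e *_) (sym (fromℕ≡Q n))) (bound v)
    where
    ρ : ℚ
    ρ = Q 512 * (e ² * e ²)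
    r<ρ : r < ρ
    r<ρ = ℚ.<-trans r<p (L<U b Lp above)
    large : 1ℚ ≤ Q n * (e ⁸ ² ²)
    large = go n u₀ 1/n<r¹⁰
      where
      go : ∀ n → Fin n → ratio 1 n < r ^ 10 → 1ℚ ≤ Q n * (e ⁸ ² ²)
      go (suc k) _ 1/n<r¹⁰ = large-n {k} (ℚ.<⇒≤ 0<e) small 0<r r<ρ 1/n<r¹⁰
    0≤d : 0ℚ ≤ density G
    0≤d = let x , Ux , x<d = b<d in ℚ.<⇒≤ (ℚ.<-trans (ℚ.<-trans 0<r r<p) (ℚ.<-trans (L<U b Lp Ux) x<d))
    open SparseOrDense {n} 0<e eK≡1 small large G {density G} 0≤d
    Goal : Set
    Goal = Σ[ N ∈ List (Subset n) ] EdgeDisjointTriangles G N × (∀ v → deg (adj (G ∖⋃ N)) v < e * Q n)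
    sparse-case : Q 8 * density G ≤ e → Goal
    sparse-case 8d≤e = [] , ([] , []) , sparse 8d≤e λ v →
      subst (λ q → fromℕ (degree G v) ≤ (1ℚ + ρ) * (density G * q)) (fromℕ≡Q n)
          (proj₂ (proj₁ typical v ρ above))
    dense-case : e ≤ Q 8 * density G → Goal
    dense-case e≤8d = dense e≤8d (λ u v u≢v →
      subst (λ q → (1ℚ - ρ) * (density G * density G * q) ≤ fromℕ (codegree G u v)
                 × fromℕ (codegree G u v) ≤ (1ℚ + ρ) * (density G * density G * q))
        (fromℕ≡Q n) (proj₂ typical u v u≢v ρ above)) u₀

-- The first guess. Every scale found is a guess halved at least once, so 4096e₀ = 1 yields 8192e ≤
-- 1.
e₀ : ℚ
e₀ = ratio 1 4096

0<e₀ : 0ℚ < e₀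
0<e₀ = ℚ.positive⁻¹ e₀

β₀ : ℚ
β₀ = Q 32 * (e₀ ² * e₀ ²)

theorem2p8 : Σ[ b₀ ∈ ℝ ] Σ[ n₀ ∈ ℕ ] (fromℚ 0ℚ <ᵣ b₀ ×
    ((n : ℕ) (b : ℝ) (G : Graph n) →
    n₀ ℕ.< n →
    root 10 (fromℚ (ratio 1 n)) <ᵣ b → b <ᵣ b₀ →
    Typical b G →
    b <ᵣ fromℚ (density G) →
    Σ[ N ∈ List (Subset n) ]
    (EdgeDisjointTriangles G N × Bounded (root 4 b) (G ∖⋃ N))))
-- b₀ is chosen so that b < b₀ is the upper cut of the first guess. n₀ = 0: n^(-0.1) < b < b₀ forces
-- n to be large, and n₀ < n provides a vertex.
theorem2p8 = fromℚ β₀ , 0 , ℚ.<-dense 0<β₀ , λ where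
    (suc n) b G _ (p , (r , r<p , 0<r , 1/n<r¹⁰) , Lp) (x , Ux , x<β₀) typical b<d →
      nearly-decompose b G 0<r r<p 1/n<r¹⁰ Lp typical b<d zero
          (scale b (ℚ.<-trans 0<r r<p) Lp (U-closed b x<β₀ Ux))
  where
  0<β₀ : 0ℚ < β₀
  0<β₀ = lit< 31 ⊗< (0<e₀ ⊗< 0<e₀ ⊗< (0<e₀ ⊗< 0<e₀))
  scale : ∀ b {p} → 0ℚ < p → L b p → U b β₀ → Scale b
  scale b {p} 0<p Lp Uβ₀ =
    let i , 0<i , pi≡1 = inverse 0<p
        fuel , ≤fuel = archimedean (Q 32 * i)
    in find-scale b {F = Q 32 * i} 0<p Lp
         (ℚ.≤-reflexive (sym (trans (eq p i) (trans (cong (Q 32 *_) pi≡1) (ℚ.*-identityʳ (Q 32))))))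
         fuel {e₀} {Q 4096} (≤-by (gap ≤fuel ⊕ lit 4096) (eq′ (Q fuel) (Q 32 * i)))
         (0<e₀ , refl , ≤-by (lit 4095) refl , ≤-by ℚ.≤-refl refl , Uβ₀)
    where
    eq : ∀ p i → Q 32 * i * p ≡ Q 32 * (p * i)
    eq = solve-∀ ℚ-ring
    eq′ : ∀ f x → f + Q 4096 - x ≡ f - x + Q 4096
    eq′ = solve-∀ ℚ-ring
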